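{- Let $r\ge 1$ and let $\mathcal{H}$, $\widetilde{f}$, $\diamond_s$, $z_s^{\delta}$, $\mathcal{A}_r$, $\mathcal{A}_1^1$ be as in the context. For every $f\in\mathcal{H}$ there exists a unique $F_f\in\mathcal{A}_1^1$ such that \[ \widetilde{f}(z_s^{\delta}w)=z_s^{\delta}\,(F_f\diamond_s w) \] holds for every $s\in\mu_r$ and every $w\in\mathcal{A}_r$.
   Context: Let $r\ge1$ and $\mu_r$ the set of $r$-th roots of unity. Let $\mathcal{A}_r=\mathbb{Q}\langle x,y_s\mid s\in\mu_r\rangle$ (noncommutative polynomials), write $y=y_1$, $z=x+y_1$, $z_t=x+y_t$, and $z_s^{\delta}=x+\delta(s)y_s$ where $\delta(1)=0$ and $\delta(s)=1$ for $s\ne1$. Put $z_{k,s}=x^{k-1}y_s$. Let $\mathcal{A}_1=\mathbb{Q}\langle x,y\rangle\subset\mathcal{A}_r$ and $\mathcal{A}_1^1=\mathbb{Q}\oplus\mathcal{A}_1y$. For $w\in\mathcal{A}_r$ let $R_w$ denote right multiplication by $w$. Maps: $\varphi$ is the algebra automorphism of $\mathcal{A}_r$ with $\varphi(x)=z$, $\varphi(y_s)=\delta(s)y_s-y_1$ ($s\in\mu_r$). $\mathcal{I}$ and $M_s$ ($s\in\mu_r$) are the linear maps with $\mathcal{I}(z_{k_1,s_1}\cdots z_{k_l,s_l}x^a)=z_{k_1,s_1}z_{k_2,s_1s_2}\cdots z_{k_l,s_1\cdots s_l}x^a$ and $M_s(z_{k_1,s_1}\cdots z_{k_l,s_l}x^a)=z_{k_1,ss_1}z_{k_2,s_2}\cdots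 z_{k_l,s_l}x^a$ ($a\ge0$; for $l=0$ both are the identity on $x^a$), and $\psi_s=\varphi\mathcal{I}M_s$. Diamond product: for $s\in\mu_r$, $\diamond_s:\mathcal{A}_1\times\mathcal{A}_r\to\mathcal{A}_r$ is the $\mathbb{Q}$-bilinear map defined recursively on words $v\in\mathcal{A}_1$, $w\in\mathcal{A}_r$ and $1\ne t\in\mu_r$ by $1\diamond_s w=w$, $v\diamond_s1=\psi_s\varphi(v)$, $vx\diamond_s wx=(v\diamond_s wx)x-(vy\diamond_s w)x$, $vy\diamond_s wx=(v\diamond_s wx)y+(vy\diamond_s w)x$, $vx\diamond_s wy=(v\diamond_s wy)x+(vx\diamond_s w)y$, $vy\diamond_s wy=(v\diamond_s wy)y-(vx\diamond_s w)y$, $vx\diamond_s wy_t=(v\diamond_s wy_t)x+(v\diamond_s wz_t)y_t-(vy\diamond_s w)y_t$, $vy\diamond_s wy_t=(v\diamond_s wy_t)y-(v\diamond_s wz_t)y_t+(vy\diamond_s w)y_t$. Rooted trees: $\mathcal{H}$ is the Connes–Kreimer Hopf algebra: the commutative $\mathbb{Q}$-algebra with basis the rooted forests (disjoint unions of non-planar rooted trees), unit the empty forest $\mathbb{I}$. $B_+$ is the linear grafting map sending a forest to the tree obtained by joining all its roots to a new root ($B_+(\mathbb{I})=\bullet$, the one-vertex tree). The coproduct $\Delta$ is the algebra map with $\Delta(\mathbb{I})=\mathbb{I}\otimes\mathbb{I}$ and $\Delta(B_+(f))=B_+(f)\otimes\mathbb{I}+(\mathrm{id}\otimes B_+)\Delta(f)$.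 Rooted tree maps: $\widetilde{\mathbb{I}}=\mathrm{id}$, and for a forest $f$ of positive degree, $\widetilde{f}\in\mathrm{End}_{\mathbb{Q}}(\mathcal{A}_r)$ is determined by: (I) $\widetilde{\bullet}(z_s^{\delta})=z_s^{\delta}(z-z_s^{\delta})$, $\widetilde{\bullet}(z)=0$; (II) $\widetilde{B_+(f)}(z_s^{\delta})=R_{z-z_s^{\delta}}R_{2z-z_s^{\delta}}R_{z-z_s^{\delta}}^{ -1}\widetilde{f}(z_s^{\delta})$ and $\widetilde{B_+(f)}(z)=0$; (III) $\widetilde{gh}(u)=\widetilde{g}(\widetilde{h}(u))$ for $u\in\{z,z_s^{\delta}\mid s\in\mu_r\}$; (IV) $\widetilde{f}(wu)=\sum_{(f)}\widetilde{f'}(w)\widetilde{f''}(u)$ for $w\in\mathcal{A}_r$, $u\in\{z,z_s^\delta\mid s\in\mu_r\}$, where $\Delta(f)=\sum_{(f)}f'\otimes f''$. (Here $\widetilde{f}(z_s^\delta)$ always ends with $z-z_s^\delta$, so (II) is well defined.) The assignment $f\mapsto\widetilde f$ is extended linearly to $\mathcal{H}$ and is an algebra homomorphism. -}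

module Defs where

open import Data.Nat as ℕ using (ℕ; zero; suc; NonZero; >-nonZero⁻¹)
open import Data.Nat.DivMod using (_%_; m%n<n)
open import Data.Fin as Fin using (Fin; toℕ; fromℕ<)
import Data.Fin.Properties as FinP
open import Data.Rational as Q using (ℚ; 0ℚ; 1ℚ)
import Data.Rational.Properties as QP
open import Data.List using (List; []; _∷_; _++_; map; concatMap; reverse; [_])
import Data.List.Properties as LP
open import Data.Product using (_×_; _,_; proj₁; proj₂; ∃)
open import Data.Sum using (_⊎_)
open import Data.Bool using (Bool; true; false; if_then_else_)
open import Relation.Nullary using (yes; no; ¬_)
open import Relation.Nullary.Decidable using (does)
open import Relation.Binary.Definitions using (DecidableEquality)
open import Relation.Binary.PropositionalEquality using (_≡_; refl)

-- A rooted tree is B₊ applied to a forest (list of trees).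
-- Lists are (planar) representatives of the non-planar forests;
-- the forest  t₁ … tₙ  is the commutative product of its trees.
data Tree : Set where
  node : List Tree → Tree

Forest : Set
Forest = List Tree

B₊ : Forest → Tree
B₊ = node

mutual
  sizeT : Tree → ℕ
  sizeT (node ts) = suc (sizeF ts)

  sizeF : Forest → ℕ
  sizeF []       = 0
  sizeF (t ∷ ts) = sizeT t ℕ.+ sizeF ts

-- Coproduct, as a list of terms f' ⊗ f'' (repetitions = multiplicities):
--   Δ(B₊ g) = B₊ g ⊗ 𝕀 + (id ⊗ B₊) Δ g ,  Δ multiplicative, Δ 𝕀 = 𝕀 ⊗ 𝕀.
mutual
  ΔT : Tree → List (Forest × Forest)
  ΔT (node g) = ([ node g ] , []) ∷ map (λ p → (proj₁ p , [ node (proj₂ p) ])) (ΔF g)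

  ΔF : Forest → List (Forest × Forest)
  ΔF []       = [ ([] , []) ]
  ΔF (t ∷ ts) = concatMap (λ p → map (λ q → (proj₁ p ++ proj₁ q , proj₂ p ++ proj₂ q)) (ΔF ts)) (ΔT t)

-- Elements of ℋ: finite ℚ-linear combinations of forests.
ℋ : Set
ℋ = List (ℚ × Forest)

-- μ_r is represented by Fin r :  k ↦ exp(2πik/r); 1 ↦ zero.
data Letter (r : ℕ) : Set where
  𝕩 : Letter r
  𝕪 : Fin r → Letter r

_≟L_ : ∀ {r} → DecidableEquality (Letter r)
𝕩 ≟L 𝕩 = yes refl
𝕩 ≟L 𝕪 _ = no λ ()
𝕪 _ ≟L 𝕩 = no λ ()
𝕪 s ≟L 𝕪 t with s Fin.≟ t
... | yes refl = yes refl
... | no s≢t  = no λ { refl → s≢t refl }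

Word : ℕ → Set
Word r = List (Letter r)

Poly : ℕ → Set
Poly r = List (ℚ × Word r)

coeff : ∀ {r} → Poly r → Word r → ℚ
coeff []             w = 0ℚ
coeff ((c , v) ∷ p)  w = if does (LP.≡-dec _≟L_ v w) then c Q.+ coeff p w else coeff p w

infix 4 _≈_
_≈_ : ∀ {r} → Poly r → Poly r → Set
p ≈ q = ∀ w → coeff p w ≡ coeff q w

module _ {r : ℕ} where
  word : Word r → Poly r
  word w = [ (1ℚ , w) ]

  scale : ℚ → Poly r → Poly r
  scale c = map (λ t → (c Q.* proj₁ t , proj₂ t))

  infixl 6 _⊕_ _⊖_
  infixl 7 _⊗_
  _⊕_ : Poly r → Poly r → Poly r
  p ⊕ q = p ++ q

  _⊖_ : Poly r → Poly r → Poly r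
  p ⊖ q = p ++ scale (Q.- 1ℚ) q

  _⊗_ : Poly r → Poly r → Poly r
  p ⊗ q = concatMap (λ t → map (λ u → (proj₁ t Q.* proj₁ u , proj₂ t ++ proj₂ u)) q) p

  linExt : (Word r → Poly r) → Poly r → Poly r
  linExt f = concatMap (λ t → scale (proj₁ t) (f (proj₂ t)))

module _ {r : ℕ} .{{nz : NonZero r}} where

  one : Fin r
  one = fromℕ< (>-nonZero⁻¹ r)

  _·μ_ : Fin r → Fin r → Fin r
  s ·μ t = fromℕ< (m%n<n (toℕ s ℕ.+ toℕ t) r)

  isOne : Fin r → Bool
  isOne s = does (s Fin.≟ one)

  xP : Poly r
  xP = word [ 𝕩 ]

  yP : Fin r → Poly r
  yP s = word [ 𝕪 s ]

  zP : Poly r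
  zP = xP ⊕ yP one

  zt : Fin r → Poly r
  zt t = xP ⊕ yP t

  zδ : Fin r → Poly r
  zδ s = if isOne s then xP else xP ⊕ yP s

  φL : Letter r → Poly r
  φL 𝕩     = zP
  φL (𝕪 s) = if isOne s then scale (Q.- 1ℚ) (yP one) else yP s ⊖ yP one

  φW : Word r → Poly r
  φW []      = word []
  φW (a ∷ w) = φL a ⊗ φW w

  φ : Poly r → Poly r
  φ = linExt φW

  -- 𝓘 : z_{k₁,s₁} z_{k₂,s₂} ⋯ x^a ↦ z_{k₁,s₁} z_{k₂,s₁s₂} ⋯ x^a
  𝓘W : Fin r → Word r → Word r
  𝓘W acc []        = []
  𝓘W acc (𝕩 ∷ w)   = 𝕩 ∷ 𝓘W acc w
  𝓘W acc (𝕪 s ∷ w) = 𝕪 (acc ·μ s) ∷ 𝓘W (acc ·μ s) w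

  𝓘 : Poly r → Poly r
  𝓘 = linExt (λ w → word (𝓘W one w))

  -- M_s : z_{k₁,s₁} z_{k₂,s₂} ⋯ x^a ↦ z_{k₁,s s₁} z_{k₂,s₂} ⋯ x^a
  MW : Fin r → Word r → Word r
  MW s []        = []
  MW s (𝕩 ∷ w)   = 𝕩 ∷ MW s w
  MW s (𝕪 t ∷ w) = 𝕪 (s ·μ t) ∷ w

  M : Fin r → Poly r → Poly r
  M s = linExt (λ w → word (MW s w))

  ψ : Fin r → Poly r → Poly r
  ψ s p = φ (𝓘 (M s p))

data L1 : Set where
  X Y : L1

_≟1_ : DecidableEquality L1
X ≟1 X = yes refl
X ≟1 Y = no λ ()
Y ≟1 X = no λ ()
Y ≟1 Y = yes refl

Word₁ : Set
Word₁ = List L1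

Poly₁ : Set
Poly₁ = List (ℚ × Word₁)

coeff₁ : Poly₁ → Word₁ → ℚ
coeff₁ []            w = 0ℚ
coeff₁ ((c , v) ∷ p) w = if does (LP.≡-dec _≟1_ v w) then c Q.+ coeff₁ p w else coeff₁ p w

infix 4 _≈₁_
_≈₁_ : Poly₁ → Poly₁ → Set
p ≈₁ q = ∀ w → coeff₁ p w ≡ coeff₁ q w

-- membership in 𝒜₁¹ = ℚ ⊕ 𝒜₁ y : every word occurring with nonzero
-- coefficient is empty or ends with y
InA11 : Poly₁ → Set
InA11 F = ∀ v → ¬ (coeff₁ F v ≡ 0ℚ) → (v ≡ []) ⊎ (∃ λ u → v ≡ u ++ [ Y ])

module _ {r : ℕ} .{{nz : NonZero r}} where

  emb : L1 → Letter r
  emb X = 𝕩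
  emb Y = 𝕪 one

  -- The diamond product ⋄_s on words.  Words are passed REVERSED
  -- (head = last letter), so that the recursion on the last letters
  -- is structural.  d' v₀ b rw  computes  (v₀ b) ⋄_s w  with
  -- v₀ = reverse of the prefix, b the last letter of v, rw = reverse w.
  module _ (s : Fin r) where
    mutual
      dv : List L1 → List (Letter r) → Poly r
      dv []       rw = word (reverse rw)
      dv (b ∷ v₀) rw = d' v₀ b rw

      d' : List L1 → L1 → List (Letter r) → Poly r
      d' v₀ b [] = ψ s (φ (word (map emb (reverse (b ∷ v₀)))))
      d' v₀ X (𝕩 ∷ rw) = dv v₀ (𝕩 ∷ rw) ⊗ xP ⊖ d' v₀ Y rw ⊗ xP
      d' v₀ Y (𝕩 ∷ rw) = dv v₀ (𝕩 ∷ rw) ⊗ yP one ⊕ d' v₀ Y rw ⊗ xP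
      d' v₀ X (𝕪 t ∷ rw) =
        if isOne t
        then dv v₀ (𝕪 t ∷ rw) ⊗ xP ⊕ d' v₀ X rw ⊗ yP one
        else dv v₀ (𝕪 t ∷ rw) ⊗ xP ⊕ (dv v₀ (𝕩 ∷ rw) ⊕ dv v₀ (𝕪 t ∷ rw)) ⊗ yP t
               ⊖ d' v₀ Y rw ⊗ yP t
      d' v₀ Y (𝕪 t ∷ rw) =
        if isOne t
        then dv v₀ (𝕪 t ∷ rw) ⊗ yP one ⊖ d' v₀ X rw ⊗ yP one
        else dv v₀ (𝕪 t ∷ rw) ⊗ yP one ⊖ (dv v₀ (𝕩 ∷ rw) ⊕ dv v₀ (𝕪 t ∷ rw)) ⊗ yP t
               ⊕ d' v₀ Y rw ⊗ yP t

  diamond : Fin r → Poly₁ → Poly r → Poly r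
  diamond s F w =
    concatMap (λ t → concatMap (λ u → scale (proj₁ t Q.* proj₁ u)
                                        (dv s (reverse (proj₂ t)) (reverse (proj₂ u)))) w) F

  syntax diamond s F w = F ⋄[ s ] w

  data Gen : Set where
    Zg : Gen
    Dg : Fin r → Gen

  genPoly : Gen → Poly r
  genPoly Zg     = zP
  genPoly (Dg s) = zδ s

  -- R_{z − z_s^δ}^{-1}.  Since z − z_s^δ = y₁ (s = 1) resp. y₁ − y_s (s ≠ 1),
  -- for p = P (z − z_s^δ) the polynomial P consists exactly of the terms of p
  -- ending in y₁, with that last letter removed.
  rdivW : ℚ → List (Letter r) → Poly r
  rdivW c []          = []
  rdivW c (𝕩 ∷ rw)    = []
  rdivW c (𝕪 t ∷ rw)  = if isOne t then [ (c , reverse rw) ] else []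

  rdiv : Poly r → Poly r
  rdiv = concatMap (λ t → rdivW (proj₁ t) (reverse (proj₂ t)))

  -- Level-indexed definition (the level n bounds the number of vertices
  -- of the forest; level sizeF f suffices for f, see treeMapF below).
  --   gen n f u     = f~(u)   for u a generator
  --   appW n f rw   = f~(w)   for w = reverse rw   (rule (IV), f~(1) = 0)
  --   appP n f p    = f~(p)
  mutual
    gen : ℕ → Forest → Gen → Poly r
    gen n       []      u = genPoly u
    gen zero    (_ ∷ _) u = []
    gen (suc n) (node [] ∷ []) Zg     = []
    gen (suc n) (node [] ∷ []) (Dg s) = zδ s ⊗ (zP ⊖ zδ s)
    gen (suc n) (node (t ∷ ts) ∷ []) Zg     = []
    gen (suc n) (node (t ∷ ts) ∷ []) (Dg s) =
      rdiv (gen n (t ∷ ts) (Dg s)) ⊗ (zP ⊕ zP ⊖ zδ s) ⊗ (zP ⊖ zδ s)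
    gen (suc n) (t ∷ t' ∷ ts) u = appP n [ t ] (gen n (t' ∷ ts) u)

    -- value on a letter, by linearity:  x = z_1^δ,  y₁ = z − z_1^δ,
    -- y_s = z_s^δ − z_1^δ  (s ≠ 1)
    genL : ℕ → Forest → Letter r → Poly r
    genL n f 𝕩     = gen n f (Dg one)
    genL n f (𝕪 t) = if isOne t then gen n f Zg ⊖ gen n f (Dg one)
                                else gen n f (Dg t) ⊖ gen n f (Dg one)

    appW : ℕ → Forest → List (Letter r) → Poly r
    appW n []       rw       = word (reverse rw)
    appW n (t ∷ ts) []       = []
    appW n (t ∷ ts) (a ∷ rw) =
      concatMap (λ p → appW n (proj₁ p) rw ⊗ genL n (proj₂ p) a) (ΔF (t ∷ ts))

    appP : ℕ → Forest → Poly r → Poly r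
    appP n f = concatMap (λ t → scale (proj₁ t) (appW n f (reverse (proj₂ t))))

  treeMapF : Forest → Poly r → Poly r
  treeMapF f = appP (sizeF f) f

  treeMap : ℋ → Poly r → Poly r
  treeMap h p = concatMap (λ t → scale (proj₁ t) (treeMapF (proj₂ t) p)) h

{-# OPTIONS --safe #-}

-- Right multiplication R_z and the operation 𝒴, which sends a linear operator E of 𝒜_r to
-- the operator 𝒴 E with
--   𝒴 E (1) = 0,   𝒴 E (p z) = 𝒴 E (p) z,   𝒴 E (p u) = 𝒴 E (p) u + E (p u) (z − u)   (u = z_s^δ),
-- generate both sides of the theorem.  Put D_1 = id, D_{vy} = 𝒴 D_v and D_{vx} = R_z D_v − 𝒴 D_v;
-- the recursion of ⋄_s then says D_v (z_s^δ w) = z_s^δ (v ⋄_s w), for all s at once.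
-- For forests f define operators U_f, L_f (upperF, lowerF below) with U_𝕀 = id, L_𝕀 = 0,
--   L_{B₊ f} = R_z L_f + U_f,   U_{B₊ f} = 𝒴 L_{B₊ f},
--   U_{fg} = U_f U_g,   L_{fg} = U_f L_g + L_f U_g − R_z L_f L_g;
-- they satisfy U_f (p u) = U_f (p) u + L_f (p u) (z − u).  A Leibniz rule for both along Δ,
-- proved without coassociativity, identifies U_f with the rooted tree map.  The span of the D_v
-- is closed under R_z, 𝒴 and composition, so it contains L_f and, for f ≠ 𝕀, U_f = 𝒴 L_f; the
-- words representing the latter end in y.
-- Uniqueness follows from v ⋄_1 1 = v.

module Submission where

open import Algebra.Bundles using (CommutativeRing; Ring)
import Algebra.Properties.CommutativeSemigroup as CommSemigroupProperties
import Algebra.Properties.Ring as RingProperties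
open import Data.Bool using (Bool; true; false; not; if_then_else_)
import Data.Bool.Properties as BoolP
open import Data.Empty using (⊥-elim)
open import Data.Fin as Fin using (Fin; toℕ)
import Data.Fin.Properties as FinP
open import Data.List using (List; []; _∷_; _++_; map; concatMap; reverse; [_])
import Data.List.Properties as LP
open import Data.List.Relation.Unary.All as All using (All; []; _∷_)
import Data.List.Relation.Unary.All.Properties as AllP
open import Data.Nat as ℕ using (ℕ; suc; NonZero)
open import Data.Nat.DivMod using (_%_; m<n⇒m%n≡m)
import Data.Nat.Properties as ℕP
open import Data.Product using (Σ; _×_; _,_; proj₁; proj₂; ∃)
open import Data.Rational as Q using (ℚ; 0ℚ; 1ℚ)
import Data.Rational.Properties as QP
open import Data.Sum using (_⊎_; inj₁; inj₂)
open import Data.Vec using (Vec; []; _∷_; lookup)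
open import Function using (_∘_)
open import Function.Bundles using (mk⇔)
open import Level using (0ℓ)
open import Relation.Binary.PropositionalEquality as ≡ using (_≡_; refl; cong; cong₂)
import Relation.Binary.Reasoning.Setoid as SetoidReasoning
open import Relation.Nullary using (yes; no; does)
open import Relation.Nullary.Decidable using (dec-true; does-⇔)

open import Defs

-- Equations in noncommutative rings, decided by expanding the difference of the
-- two sides into signed monomials and cancelling opposite ones.

-- L_f turns rule (II) into an operator. For u = z_s^δ and f ≠ 𝕀, the value U_f (u) is divisible on
-- the right by z - u, and L_f (u) is the quotient. Since 2z - u = z + (z - u), rule (II) reads
-- U_{B₊ f} (u) = (L_f (u) z + U_f (u)) (z - u), which dictates the formula for L_{B₊ f}. The
-- formula for L_{fg} is the one that makes U_f - R_z L_f multiplicative. The obstacle is that the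
-- rooted tree maps recurse through Δ on words, which fits badly with composing them. The operators
-- U_f and L_f are built along the forest alone, and Δ enters only through the Leibniz rules: the
-- one for L passes from g to B₊ g, and for a tree the one for U follows from it by induction on the
-- right factor. One D_v serves every s because the dependence of ⋄_s on s sits in v ⋄_s 1 = ψ_s φ
-- (v). On 𝒜₁ the map ψ_s φ substitutes z_s^δ for x and z - z_s^δ for y, and D_v (z_s^δ) is z_s^δ
-- times the same substitution.

module NoncommutativeSolver {c ℓ} (R : Ring c ℓ) where
  open Ring R hiding (zero) renaming (_≈_ to _≃_; refl to ≃-refl)
  open RingProperties R
  open CommSemigroupProperties +-commutativeSemigroup using (x∙yz≈y∙xz)
  open SetoidReasoning setoid

  infixl 6 _:+_ _:-_
  infixl 7 _:*_

  data Expr (n : ℕ) : Set where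
    var            : Fin n → Expr n
    :0             : Expr n
    _:+_ _:-_ _:*_ : Expr n → Expr n → Expr n

  SignedMonomial : ℕ → Set
  SignedMonomial n = Bool × List (Fin n)

  ⟦_⟧ : ∀ {n} → Expr n → Vec Carrier n → Carrier
  ⟦ var i ⟧ ρ  = lookup ρ i
  ⟦ :0 ⟧ ρ     = 0#
  ⟦ a :+ b ⟧ ρ = ⟦ a ⟧ ρ + ⟦ b ⟧ ρ
  ⟦ a :- b ⟧ ρ = ⟦ a ⟧ ρ - ⟦ b ⟧ ρ
  ⟦ a :* b ⟧ ρ = ⟦ a ⟧ ρ * ⟦ b ⟧ ρ

  flip : ∀ {n} → SignedMonomial n → SignedMonomial n
  flip (s , m) = not s , m

  multiply : ∀ {n} → SignedMonomial n → SignedMonomial n → SignedMonomial n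
  multiply (s , m) (t , k) = (if s then t else not t) , m ++ k

  expand : ∀ {n} → Expr n → List (SignedMonomial n)
  expand (var i)  = [ true , [ i ] ]
  expand :0       = []
  expand (a :+ b) = expand a ++ expand b
  expand (a :- b) = expand a ++ map flip (expand b)
  expand (a :* b) = concatMap (λ t → map (multiply t) (expand b)) (expand a)

  insert : ∀ {n} → SignedMonomial n → List (SignedMonomial n) → List (SignedMonomial n)
  insert t []                 = [ t ]
  insert (s , m) ((t , k) ∷ l) with LP.≡-dec FinP._≟_ m k | t BoolP.≟ not s
  ... | yes _ | yes _ = l
  ... | _     | _     = (t , k) ∷ insert (s , m) l

  cancel : ∀ {n} → List (SignedMonomial n) → List (SignedMonomial n)
  cancel []      = []
  cancel (t ∷ l) = insert t (cancel l)

  signed : Bool → Carrier → Carrier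
  signed s x = if s then x else - x

  module _ {n} (ρ : Vec Carrier n) where

    mono : List (Fin n) → Carrier
    mono []      = 1#
    mono (i ∷ m) = lookup ρ i * mono m

    total : List (SignedMonomial n) → Carrier
    total []            = 0#
    total ((s , m) ∷ l) = signed s (mono m) + total l

    signed-not : ∀ s x → signed (not s) x ≃ - signed s x
    signed-not true  x = ≃-refl
    signed-not false x = sym (-‿involutive x)

    signed-* : ∀ s t x y → signed (if s then t else not t) (x * y) ≃ signed s x * signed t y
    signed-* true  true  x y = ≃-refl
    signed-* true  false x y = -‿distribʳ-* x y
    signed-* false true  x y = -‿distribˡ-* x y
    signed-* false false x y = begin
      x * y           ≈⟨ -‿involutive (x * y) ⟨
      - (- (x * y))   ≈⟨ -‿cong (-‿distribʳ-* x y) ⟩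
      - (x * (- y))   ≈⟨ -‿distribˡ-* x (- y) ⟩
      - x * - y       ∎

    signed-cong : ∀ s {x y} → x ≃ y → signed s x ≃ signed s y
    signed-cong true  e = e
    signed-cong false e = -‿cong e

    mono-++ : ∀ m k → mono (m ++ k) ≃ mono m * mono k
    mono-++ []      k = sym (*-identityˡ _)
    mono-++ (i ∷ m) k = trans (*-congˡ (mono-++ m k)) (sym (*-assoc _ _ _))

    total-++ : ∀ l k → total (l ++ k) ≃ total l + total k
    total-++ []      k = sym (+-identityˡ _)
    total-++ (_ ∷ l) k = trans (+-congˡ (total-++ l k)) (sym (+-assoc _ _ _))

    total-flip : ∀ l → total (map flip l) ≃ - total l
    total-flip []            = sym -0#≈0#
    total-flip ((s , m) ∷ l) =
      trans (+-cong (signed-not s _) (total-flip l)) (-‿+-comm _ _)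

    total-multiply : ∀ t l → total (map (multiply t) l) ≃ signed (proj₁ t) (mono (proj₂ t)) * total l
    total-multiply t       []            = sym (zeroʳ _)
    total-multiply (s , m) ((t , k) ∷ l) = begin
      signed (if s then t else not t) (mono (m ++ k)) + total (map (multiply (s , m)) l)
        ≈⟨ +-cong (trans (signed-cong (if s then t else not t) (mono-++ m k))
                         (signed-* s t _ _))
                  (total-multiply (s , m) l) ⟩
      signed s (mono m) * signed t (mono k) + signed s (mono m) * total l
        ≈⟨ distribˡ _ _ _ ⟨
      signed s (mono m) * (signed t (mono k) + total l) ∎

    total-product : ∀ l k → total (concatMap (λ t → map (multiply t) k) l) ≃ total l * total k
    total-product []      k = sym (zeroˡ _)
    total-product (t ∷ l) k = begin
      total (map (multiply t) k ++ concatMap (λ t → map (multiply t) k) l)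
        ≈⟨ total-++ (map (multiply t) k) _ ⟩
      total (map (multiply t) k) + total (concatMap (λ t → map (multiply t) k) l)
        ≈⟨ +-cong (total-multiply t k) (total-product l k) ⟩
      signed (proj₁ t) (mono (proj₂ t)) * total k + total l * total k
        ≈⟨ distribʳ _ _ _ ⟨
      (signed (proj₁ t) (mono (proj₂ t)) + total l) * total k ∎

    total-expand : ∀ e → total (expand e) ≃ ⟦ e ⟧ ρ
    total-expand (var i)  = trans (+-identityʳ _) (*-identityʳ _)
    total-expand :0       = ≃-refl
    total-expand (a :+ b) =
      trans (total-++ (expand a) _) (+-cong (total-expand a) (total-expand b))
    total-expand (a :- b) =
      trans (total-++ (expand a) _)
            (+-cong (total-expand a) (trans (total-flip (expand b)) (-‿cong (total-expand b))))
    total-expand (a :* b) =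
      trans (total-product (expand a) (expand b)) (*-cong (total-expand a) (total-expand b))

    total-insert : ∀ t l → total (insert t l) ≃ total (t ∷ l)
    total-insert t []                  = ≃-refl
    total-insert (s , m) ((t , k) ∷ l) with LP.≡-dec FinP._≟_ m k | t BoolP.≟ not s
    ... | yes refl | yes refl = begin
      total l                                                          ≈⟨ +-identityˡ _ ⟨
      0# + total l                                                     ≈⟨ +-congʳ (-‿inverseʳ _) ⟨
      signed s (mono m) - signed s (mono m) + total l                  ≈⟨ +-congʳ (+-congˡ (signed-not s _)) ⟨
      signed s (mono m) + signed (not s) (mono m) + total l            ≈⟨ +-assoc _ _ _ ⟩
      signed s (mono m) + (signed (not s) (mono m) + total l)          ∎
    ... | yes _    | no _     = trans (+-congˡ (total-insert (s , m) l)) (x∙yz≈y∙xz _ _ _)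
    ... | no _     | _        = trans (+-congˡ (total-insert (s , m) l)) (x∙yz≈y∙xz _ _ _)

    total-cancel : ∀ l → total (cancel l) ≃ total l
    total-cancel []      = ≃-refl
    total-cancel (t ∷ l) = trans (total-insert t (cancel l)) (+-congˡ (total-cancel l))

    -- The hypothesis mentions only the syntax, so for closed expressions it is settled by
    -- computation and each use passes `refl`.
    solve : ∀ a b → cancel (expand (a :- b)) ≡ [] → ⟦ a ⟧ ρ ≃ ⟦ b ⟧ ρ
    solve a b eq = x∙y⁻¹≈ε⇒x≈y _ _ (begin
      ⟦ a ⟧ ρ - ⟦ b ⟧ ρ                ≈⟨ total-expand (a :- b) ⟨
      total (expand (a :- b))          ≈⟨ total-cancel (expand (a :- b)) ⟨
      total (cancel (expand (a :- b))) ≡⟨ cong total eq ⟩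
      0#                               ∎)

-- Pairing an element of the free ℚ-module on B with the functions B → ℚ turns
-- every linear construction on lists of terms into a statement about rationals.

infix 4 _≋_

⟨_,_⟩ : {B : Set} → List (ℚ × B) → (B → ℚ) → ℚ
⟨ []          , g ⟩ = 0ℚ
⟨ (c , b) ∷ p , g ⟩ = c Q.* g b Q.+ ⟨ p , g ⟩

-- Testing against all functions, where `_≈_` uses the indicators of single words, makes congruence
-- easy: the pairing of a construction with g is the pairing of its input with a transposed
-- function. The record wrapper keeps both sides visible to unification.
record _≋_ {B : Set} (p q : List (ℚ × B)) : Set where
  constructor mk
  field pair : ∀ g → ⟨ p , g ⟩ ≡ ⟨ q , g ⟩

open _≋_ public

module _ {B : Set} where

  pairing-cong : ∀ p {g h : B → ℚ} → (∀ b → g b ≡ h b) → ⟨ p , g ⟩ ≡ ⟨ p , h ⟩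
  pairing-cong []            e = refl
  pairing-cong ((c , b) ∷ p) e = cong₂ (λ u v → c Q.* u Q.+ v) (e b) (pairing-cong p e)

  pairing-++ : ∀ (p q : List (ℚ × B)) g → ⟨ p ++ q , g ⟩ ≡ ⟨ p , g ⟩ Q.+ ⟨ q , g ⟩
  pairing-++ []            q g = ≡.sym (QP.+-identityˡ _)
  pairing-++ ((c , b) ∷ p) q g =
    ≡.trans (cong (c Q.* g b Q.+_) (pairing-++ p q g)) (≡.sym (QP.+-assoc (c Q.* g b) ⟨ p , g ⟩ ⟨ q , g ⟩))

  pairing-+ : ∀ (p : List (ℚ × B)) g h →
              ⟨ p , (λ b → g b Q.+ h b) ⟩ ≡ ⟨ p , g ⟩ Q.+ ⟨ p , h ⟩
  pairing-+ []            g h = refl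
  pairing-+ ((c , b) ∷ p) g h = begin
    c Q.* (g b Q.+ h b) Q.+ ⟨ p , (λ b → g b Q.+ h b) ⟩
      ≡⟨ cong₂ Q._+_ (QP.*-distribˡ-+ c (g b) (h b)) (pairing-+ p g h) ⟩
    (c Q.* g b Q.+ c Q.* h b) Q.+ (⟨ p , g ⟩ Q.+ ⟨ p , h ⟩)
      ≡⟨ interchange (c Q.* g b) (c Q.* h b) ⟨ p , g ⟩ ⟨ p , h ⟩ ⟩
    (c Q.* g b Q.+ ⟨ p , g ⟩) Q.+ (c Q.* h b Q.+ ⟨ p , h ⟩) ∎
    where
    open ≡.≡-Reasoning
    open CommSemigroupProperties (Ring.+-commutativeSemigroup QP.+-*-ring) using (interchange)

  pairing-* : ∀ (p : List (ℚ × B)) a g → ⟨ p , (λ b → a Q.* g b) ⟩ ≡ a Q.* ⟨ p , g ⟩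
  pairing-* []            a g = ≡.sym (QP.*-zeroʳ a)
  pairing-* ((c , b) ∷ p) a g = begin
    c Q.* (a Q.* g b) Q.+ ⟨ p , (λ b → a Q.* g b) ⟩
      ≡⟨ cong₂ Q._+_ (x∙yz≈y∙xz c a (g b)) (pairing-* p a g) ⟩
    a Q.* (c Q.* g b) Q.+ a Q.* ⟨ p , g ⟩
      ≡⟨ QP.*-distribˡ-+ a _ _ ⟨
    a Q.* (c Q.* g b Q.+ ⟨ p , g ⟩) ∎
    where
    open ≡.≡-Reasoning
    open CommSemigroupProperties (CommutativeRing.*-commutativeSemigroup QP.+-*-commutativeRing)
      using (x∙yz≈y∙xz)

  pairing-0 : ∀ (p : List (ℚ × B)) → ⟨ p , (λ _ → 0ℚ) ⟩ ≡ 0ℚ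
  pairing-0 []            = refl
  pairing-0 ((c , b) ∷ p) = ≡.cong₂ Q._+_ (QP.*-zeroʳ c) (pairing-0 p)

  pairing-scale : ∀ c (p : List (ℚ × B)) g →
                  ⟨ map (λ t → c Q.* proj₁ t , proj₂ t) p , g ⟩ ≡ c Q.* ⟨ p , g ⟩
  pairing-scale c []            g = ≡.sym (QP.*-zeroʳ c)
  pairing-scale c ((a , b) ∷ p) g =
    ≡.trans (cong₂ Q._+_ (QP.*-assoc c a (g b)) (pairing-scale c p g))
            (≡.sym (QP.*-distribˡ-+ c _ _))

  pairing-word : ∀ (b : B) g → ⟨ [ 1ℚ , b ] , g ⟩ ≡ g b
  pairing-word b g = ≡.trans (QP.+-identityʳ _) (QP.*-identityˡ _)

  ≋-refl : {p : List (ℚ × B)} → p ≋ p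
  ≋-refl = mk λ _ → refl

  ≋-sym : {p q : List (ℚ × B)} → p ≋ q → q ≋ p
  ≋-sym e = mk λ g → ≡.sym (pair e g)

  ≋-trans : {p q s : List (ℚ × B)} → p ≋ q → q ≋ s → p ≋ s
  ≋-trans e f = mk λ g → ≡.trans (pair e g) (pair f g)

  ≋-reflexive : {p q : List (ℚ × B)} → p ≡ q → p ≋ q
  ≋-reflexive refl = ≋-refl

-- Definitionally `linExt` when the basis consists of words, so `φ`, `𝓘` and `M` are instances; the
-- basis may also be the forests or the words of 𝒜₁.
lin : ∀ {r} {B : Set} → (B → Poly r) → List (ℚ × B) → Poly r
lin f = concatMap (λ t → scale (proj₁ t) (f (proj₂ t)))

module _ {r : ℕ} where

  pairing-lin : ∀ {B : Set} (f : B → Poly r) p g →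
                ⟨ lin f p , g ⟩ ≡ ⟨ p , (λ b → ⟨ f b , g ⟩) ⟩
  pairing-lin f []            g = refl
  pairing-lin f ((c , b) ∷ p) g =
    ≡.trans (pairing-++ (scale c (f b)) _ g)
            (cong₂ Q._+_ (pairing-scale c (f b) g) (pairing-lin f p g))

  pairing-⊗ : ∀ (p q : Poly r) g →
              ⟨ p ⊗ q , g ⟩ ≡ ⟨ p , (λ v → ⟨ q , (λ w → g (v ++ w)) ⟩) ⟩
  pairing-⊗ []            q g = refl
  pairing-⊗ ((c , v) ∷ p) q g =
    ≡.trans (pairing-++ (map (λ u → c Q.* proj₁ u , v ++ proj₂ u) q) _ g)
            (cong₂ Q._+_ (row q) (pairing-⊗ p q g))
    where
    row : ∀ q → ⟨ map (λ u → c Q.* proj₁ u , v ++ proj₂ u) q , g ⟩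
                ≡ c Q.* ⟨ q , (λ w → g (v ++ w)) ⟩
    row []            = ≡.sym (QP.*-zeroʳ c)
    row ((d , w) ∷ q) =
      ≡.trans (cong₂ Q._+_ (QP.*-assoc c d _) (row q)) (≡.sym (QP.*-distribˡ-+ c _ _))

  -- Chosen so that `p ⊖ q` is definitionally the ring subtraction to which `solve` applies.
  neg : Poly r → Poly r
  neg = scale (Q.- 1ℚ)

  pairing-neg : ∀ p g → ⟨ neg p , g ⟩ ≡ Q.- ⟨ p , g ⟩
  pairing-neg p g =
    ≡.trans (pairing-scale (Q.- 1ℚ) p g) (RingProperties.-1*x≈-x QP.+-*-ring _)

  ⊕-cong : {p p′ q q′ : Poly r} → p ≋ p′ → q ≋ q′ → p ⊕ q ≋ p′ ⊕ q′
  ⊕-cong {p} {p′} e f = mk λ g →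
    ≡.trans (pairing-++ p _ g)
            (≡.trans (cong₂ Q._+_ (pair e g) (pair f g)) (≡.sym (pairing-++ p′ _ g)))

  neg-cong : {p q : Poly r} → p ≋ q → neg p ≋ neg q
  neg-cong {p} {q} e = mk λ g →
    ≡.trans (pairing-neg p g) (≡.trans (cong Q.-_ (pair e g)) (≡.sym (pairing-neg q g)))

  scale-cong : ∀ c {p q : Poly r} → p ≋ q → scale c p ≋ scale c q
  scale-cong c {p} {q} e = mk λ g →
    ≡.trans (pairing-scale c p g) (≡.trans (cong (c Q.*_) (pair e g)) (≡.sym (pairing-scale c q g)))

  ⊗-cong : {p p′ q q′ : Poly r} → p ≋ p′ → q ≋ q′ → p ⊗ q ≋ p′ ⊗ q′
  ⊗-cong {p} {p′} {q} {q′} e f = mk λ g → begin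
    ⟨ p ⊗ q , g ⟩                                       ≡⟨ pairing-⊗ p q g ⟩
    ⟨ p , (λ v → ⟨ q , (λ w → g (v ++ w)) ⟩) ⟩          ≡⟨ pairing-cong p (λ v → pair f _) ⟩
    ⟨ p , (λ v → ⟨ q′ , (λ w → g (v ++ w)) ⟩) ⟩         ≡⟨ pair e _ ⟩
    ⟨ p′ , (λ v → ⟨ q′ , (λ w → g (v ++ w)) ⟩) ⟩        ≡⟨ pairing-⊗ p′ q′ g ⟨
    ⟨ p′ ⊗ q′ , g ⟩                                     ∎
    where open ≡.≡-Reasoning

  ⊗-assoc : ∀ (p q s : Poly r) → (p ⊗ q) ⊗ s ≋ p ⊗ (q ⊗ s)
  ⊗-assoc p q s = mk λ g → begin
    ⟨ (p ⊗ q) ⊗ s , g ⟩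
      ≡⟨ pairing-⊗ (p ⊗ q) s g ⟩
    ⟨ p ⊗ q , (λ v → ⟨ s , (λ w → g (v ++ w)) ⟩) ⟩
      ≡⟨ pairing-⊗ p q _ ⟩
    ⟨ p , (λ u → ⟨ q , (λ v → ⟨ s , (λ w → g ((u ++ v) ++ w)) ⟩) ⟩) ⟩
      ≡⟨ pairing-cong p (λ u → pairing-cong q (λ v → pairing-cong s (λ w →
           cong g (LP.++-assoc u v w)))) ⟩
    ⟨ p , (λ u → ⟨ q , (λ v → ⟨ s , (λ w → g (u ++ (v ++ w))) ⟩) ⟩) ⟩
      ≡⟨ pairing-cong p (λ u → pairing-⊗ q s _) ⟨
    ⟨ p , (λ u → ⟨ q ⊗ s , (λ v → g (u ++ v)) ⟩) ⟩
      ≡⟨ pairing-⊗ p (q ⊗ s) g ⟨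
    ⟨ p ⊗ (q ⊗ s) , g ⟩ ∎
    where open ≡.≡-Reasoning

  ⊗-identityˡ : ∀ (p : Poly r) → word [] ⊗ p ≋ p
  ⊗-identityˡ p = mk λ g → ≡.trans (pairing-⊗ (word []) p g) (pairing-word {B = Word r} [] (λ v → ⟨ p , (λ w → g (v ++ w)) ⟩))

  ⊗-identityʳ : ∀ (p : Poly r) → p ⊗ word [] ≋ p
  ⊗-identityʳ p = mk λ g →
    ≡.trans (pairing-⊗ p (word []) g)
            (pairing-cong p λ v → ≡.trans (pairing-word {B = Word r} [] (λ w → g (v ++ w)))
                                         (cong g (LP.++-identityʳ v)))

  ⊗-distribˡ-⊕ : ∀ (p q s : Poly r) → p ⊗ (q ⊕ s) ≋ p ⊗ q ⊕ p ⊗ s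
  ⊗-distribˡ-⊕ p q s = mk λ g → begin
    ⟨ p ⊗ (q ⊕ s) , g ⟩
      ≡⟨ pairing-⊗ p (q ⊕ s) g ⟩
    ⟨ p , (λ v → ⟨ q ⊕ s , (λ w → g (v ++ w)) ⟩) ⟩
      ≡⟨ pairing-cong p (λ v → pairing-++ q s _) ⟩
    ⟨ p , (λ v → ⟨ q , (λ w → g (v ++ w)) ⟩ Q.+ ⟨ s , (λ w → g (v ++ w)) ⟩) ⟩
      ≡⟨ pairing-+ p _ _ ⟩
    ⟨ p , (λ v → ⟨ q , (λ w → g (v ++ w)) ⟩) ⟩ Q.+ ⟨ p , (λ v → ⟨ s , (λ w → g (v ++ w)) ⟩) ⟩
      ≡⟨ cong₂ Q._+_ (pairing-⊗ p q g) (pairing-⊗ p s g) ⟨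
    ⟨ p ⊗ q , g ⟩ Q.+ ⟨ p ⊗ s , g ⟩
      ≡⟨ pairing-++ (p ⊗ q) (p ⊗ s) g ⟨
    ⟨ p ⊗ q ⊕ p ⊗ s , g ⟩ ∎
    where open ≡.≡-Reasoning

  ⊗-distribʳ-⊕ : ∀ (p q s : Poly r) → (q ⊕ s) ⊗ p ≋ q ⊗ p ⊕ s ⊗ p
  ⊗-distribʳ-⊕ p q s = ≋-reflexive (LP.concatMap-++ _ q s)

  polyRing : Ring 0ℓ 0ℓ
  polyRing = record
    { Carrier = Poly r ; _≈_ = _≋_ ; _+_ = _⊕_ ; _*_ = _⊗_ ; -_ = neg ; 0# = [] ; 1# = word []
    ; isRing = record
      { +-isAbelianGroup = record
        { isGroup = record
          { isMonoid = record
            { isSemigroup = record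
              { isMagma = record
                { isEquivalence = record { refl = ≋-refl ; sym = ≋-sym ; trans = ≋-trans }
                ; ∙-cong = ⊕-cong }
              ; assoc = λ p q s → ≋-reflexive (LP.++-assoc p q s) }
            ; identity = (λ _ → ≋-refl) , λ p → ≋-reflexive (LP.++-identityʳ p) }
          ; inverse = inverseˡ , λ p → ≋-trans (⊕-comm p (neg p)) (inverseˡ p)
          ; ⁻¹-cong = neg-cong }
        ; comm = ⊕-comm }
      ; *-cong = ⊗-cong
      ; *-assoc = ⊗-assoc
      ; *-identity = ⊗-identityˡ , ⊗-identityʳ
      ; distrib = ⊗-distribˡ-⊕ , ⊗-distribʳ-⊕ } }
    where
    ⊕-comm : ∀ p q → p ⊕ q ≋ q ⊕ p
    ⊕-comm p q = mk λ g →
      ≡.trans (pairing-++ p q g) (≡.trans (QP.+-comm ⟨ p , g ⟩ ⟨ q , g ⟩) (≡.sym (pairing-++ q p g)))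
    inverseˡ : ∀ p → neg p ⊕ p ≋ []
    inverseˡ p = mk λ g →
      ≡.trans (pairing-++ (neg p) p g)
              (≡.trans (cong (Q._+ ⟨ p , g ⟩) (pairing-neg p g)) (QP.+-inverseˡ ⟨ p , g ⟩))

-- Linear operators

module _ {r : ℕ} where

  -- The one equation `linear` says that the map is determined by its values on words; additivity,
  -- homogeneity and compatibility with `_≋_` all follow from it.
  record Op : Set where
    field
      ap     : Poly r → Poly r
      linear : ∀ p g → ⟨ ap p , g ⟩ ≡ ⟨ p , (λ w → ⟨ ap (word w) , g ⟩) ⟩

  open Op public

  open Ring (polyRing {r}) public using () renaming (zeroʳ to ⊗-zeroʳ; +-identityʳ to ⊕-identityʳ)
  module ≋-Reasoning = SetoidReasoning (Ring.setoid (polyRing {r}))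
  open NoncommutativeSolver (polyRing {r}) public using (Expr; var; :0; _:+_; _:-_; _:*_; solve)

  module _ {n : ℕ} where
    x₀ : Expr (1 ℕ.+ n)
    x₀ = var Fin.zero
    x₁ : Expr (2 ℕ.+ n)
    x₁ = var (Fin.suc Fin.zero)
    x₂ : Expr (3 ℕ.+ n)
    x₂ = var (Fin.suc (Fin.suc Fin.zero))
    x₃ : Expr (4 ℕ.+ n)
    x₃ = var (Fin.suc (Fin.suc (Fin.suc Fin.zero)))
    x₄ : Expr (5 ℕ.+ n)
    x₄ = var (Fin.suc (Fin.suc (Fin.suc (Fin.suc Fin.zero))))
    x₅ : Expr (6 ℕ.+ n)
    x₅ = var (Fin.suc (Fin.suc (Fin.suc (Fin.suc (Fin.suc Fin.zero)))))
    x₆ : Expr (7 ℕ.+ n)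
    x₆ = var (Fin.suc (Fin.suc (Fin.suc (Fin.suc (Fin.suc (Fin.suc Fin.zero))))))
    x₇ : Expr (8 ℕ.+ n)
    x₇ = var (Fin.suc (Fin.suc (Fin.suc (Fin.suc (Fin.suc (Fin.suc (Fin.suc Fin.zero)))))))

  ⊕-congˡ : ∀ (p : Poly r) {q q′} → q ≋ q′ → p ⊕ q ≋ p ⊕ q′
  ⊕-congˡ p = ⊕-cong (≋-refl {p = p})

  ⊕-congʳ : ∀ (q : Poly r) {p p′} → p ≋ p′ → p ⊕ q ≋ p′ ⊕ q
  ⊕-congʳ q e = ⊕-cong e (≋-refl {p = q})

  ⊗-congˡ : ∀ (p : Poly r) {q q′} → q ≋ q′ → p ⊗ q ≋ p ⊗ q′
  ⊗-congˡ p = ⊗-cong (≋-refl {p = p})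

  ⊗-congʳ : ∀ (q : Poly r) {p p′} → p ≋ p′ → p ⊗ q ≋ p′ ⊗ q
  ⊗-congʳ q e = ⊗-cong e (≋-refl {p = q})

  ⊖-cong : {p p′ q q′ : Poly r} → p ≋ p′ → q ≋ q′ → p ⊖ q ≋ p′ ⊖ q′
  ⊖-cong e f = ⊕-cong e (neg-cong f)

  module _ (E : Op) where

    ap-cong : ∀ {p q} → p ≋ q → ap E p ≋ ap E q
    ap-cong {p} {q} e = mk λ g →
      ≡.trans (linear E p g) (≡.trans (pair e _) (≡.sym (linear E q g)))

    ap-⊕ : ∀ p q → ap E (p ⊕ q) ≋ ap E p ⊕ ap E q
    ap-⊕ p q = mk λ g →
      ≡.trans (linear E (p ⊕ q) g) (≡.trans (pairing-++ p q _)
        (≡.trans (≡.sym (cong₂ Q._+_ (linear E p g) (linear E q g)))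
                 (≡.sym (pairing-++ (ap E p) (ap E q) g))))

    ap-scale : ∀ c p → ap E (scale c p) ≋ scale c (ap E p)
    ap-scale c p = mk λ g →
      ≡.trans (linear E (scale c p) g) (≡.trans (pairing-scale c p _)
        (≡.trans (cong (c Q.*_) (≡.sym (linear E p g))) (≡.sym (pairing-scale c (ap E p) g))))

    ap-⊖ : ∀ p q → ap E (p ⊖ q) ≋ ap E p ⊖ ap E q
    ap-⊖ p q = ≋-trans (ap-⊕ p (neg q)) (⊕-congˡ (ap E p) (ap-scale (Q.- 1ℚ) q))

    ap-[] : ap E [] ≋ []
    ap-[] = mk (linear E [])

  op-ext : ∀ E F → (∀ w → ap E (word w) ≋ ap F (word w)) → ∀ p → ap E p ≋ ap F p
  op-ext E F e p = mk λ g →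
    ≡.trans (linear E p g)
            (≡.trans (pairing-cong p (λ w → pair (e w) g)) (≡.sym (linear F p g)))

  infixr 9 _∘ₒ_
  infixl 6 _+ₒ_ _-ₒ_

  idₒ : Op
  idₒ = record { ap = λ p → p ; linear = λ p g → pairing-cong p (λ w → ≡.sym (pairing-word w g)) }

  0ₒ : Op
  0ₒ = record { ap = λ _ → [] ; linear = λ p g → ≡.sym (pairing-0 p) }

  _∘ₒ_ : Op → Op → Op
  E ∘ₒ F = record
    { ap     = λ p → ap E (ap F p)
    ; linear = λ p g → ≡.trans (linear E (ap F p) g) (≡.trans (linear F p _)
                 (pairing-cong p λ w → ≡.sym (linear E (ap F (word w)) g))) }

  _+ₒ_ : Op → Op → Op
  E +ₒ F = record
    { ap     = λ p → ap E p ⊕ ap F p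
    ; linear = λ p g → ≡.trans (pairing-++ (ap E p) (ap F p) g)
        (≡.trans (cong₂ Q._+_ (linear E p g) (linear F p g))
        (≡.trans (≡.sym (pairing-+ p _ _))
                 (pairing-cong p λ w → ≡.sym (pairing-++ (ap E (word w)) (ap F (word w)) g)))) }

  scaleₒ : ℚ → Op → Op
  scaleₒ c E = record
    { ap     = λ p → scale c (ap E p)
    ; linear = λ p g → ≡.trans (pairing-scale c (ap E p) g)
        (≡.trans (cong (c Q.*_) (linear E p g))
        (≡.trans (≡.sym (pairing-* p c _))
                 (pairing-cong p λ w → ≡.sym (pairing-scale c (ap E (word w)) g)))) }

  _-ₒ_ : Op → Op → Op
  E -ₒ F = E +ₒ scaleₒ (Q.- 1ℚ) F

  lin-word : ∀ {B : Set} (f : B → Poly r) b → lin f [ 1ℚ , b ] ≋ f b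
  lin-word f b = mk λ g → ≡.trans (pairing-lin f [ 1ℚ , b ] g) (pairing-word b (λ b → ⟨ f b , g ⟩))

  linₒ : (Word r → Poly r) → Op
  linₒ f = record
    { ap     = lin f
    ; linear = λ p g → ≡.trans (pairing-lin f p g)
        (pairing-cong p λ w → ≡.sym (pair (lin-word f w) g)) }

  Rₒ : Poly r → Op
  Rₒ q = record
    { ap     = _⊗ q
    ; linear = λ p g → ≡.trans (pairing-⊗ p q g)
        (pairing-cong p λ w → ≡.sym (≡.trans (pairing-⊗ (word w) q g)
          (pairing-word w (λ v → ⟨ q , (λ w → g (v ++ w)) ⟩)))) }

  Lₒ : Poly r → Op
  Lₒ p = record
    { ap     = p ⊗_
    ; linear = λ q g → begin
        ⟨ p ⊗ q , g ⟩
          ≡⟨ pairing-⊗ p q g ⟩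
        ⟨ p , (λ v → ⟨ q , (λ w → g (v ++ w)) ⟩) ⟩
          ≡⟨ swap q _ ⟩
        ⟨ q , (λ w → ⟨ p , (λ v → g (v ++ w)) ⟩) ⟩
          ≡⟨ pairing-cong q (λ w → ≡.trans (pairing-⊗ p (word w) g)
               (pairing-cong p λ v → pairing-word w (λ w → g (v ++ w)))) ⟨
        ⟨ q , (λ w → ⟨ p ⊗ word w , g ⟩) ⟩ ∎ }
    where
    open ≡.≡-Reasoning
    swap : ∀ q (g : Word r → Word r → ℚ) →
           ⟨ p , (λ v → ⟨ q , g v ⟩) ⟩ ≡ ⟨ q , (λ w → ⟨ p , (λ v → g v w) ⟩) ⟩
    swap []            g = pairing-0 p
    swap ((c , w) ∷ q) g =
      ≡.trans (pairing-+ p _ _) (cong₂ Q._+_ (pairing-* p c _) (swap q g))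

-- Generators, the operation 𝒴 and companion pairs

module _ {r : ℕ} .{{_ : NonZero r}} where

  isOne-one : isOne {r} one ≡ true
  isOne-one = dec-true (one Fin.≟ one) refl

  one-view : (t : Fin r) → t ≡ one ⊎ isOne t ≡ false
  one-view t with t Fin.≟ one in eq
  ... | yes t≡1 = inj₁ t≡1
  ... | no  _   = inj₂ refl

  zδ-one : zδ {r} one ≡ xP
  zδ-one rewrite isOne-one = refl

  zδ-other : ∀ t → isOne t ≡ false → zδ {r} t ≡ zt t
  zδ-other t e rewrite e = refl

  yP-one : yP one ≋ zP {r} ⊖ zδ one
  yP-one rewrite isOne-one = solve (xP ∷ yP one ∷ []) x₁ (x₀ :+ x₁ :- x₀) refl

  yP-other : ∀ t → isOne t ≡ false → yP t ≋ zδ {r} t ⊖ zδ one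
  yP-other t e rewrite e | isOne-one = solve (xP ∷ yP t ∷ []) x₁ (x₀ :+ x₁ :- x₀) refl

  op-⊗-⊖ : ∀ (E : Op {r}) p q s → ap E (p ⊗ (q ⊖ s)) ≋ ap E (p ⊗ q) ⊖ ap E (p ⊗ s)
  op-⊗-⊖ E p q s =
    ≋-trans (ap-cong E (solve (p ∷ q ∷ s ∷ []) (x₀ :* (x₁ :- x₂)) (x₀ :* x₁ :- x₀ :* x₂) refl))
            (ap-⊖ E _ _)

  op-⊗-⊕ : ∀ (E : Op {r}) p q s → ap E (p ⊗ (q ⊕ s)) ≋ ap E (p ⊗ q) ⊕ ap E (p ⊗ s)
  op-⊗-⊕ E p q s = ≋-trans (ap-cong E (⊗-distribˡ-⊕ p q s)) (ap-⊕ E _ _)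

  -- Words are built from 1 by right multiplication with the generators z and z_s^δ.
  generator-induction : (E F : Op {r}) → ap E (word []) ≋ ap F (word []) →
    (∀ p → ap E p ≋ ap F p → ap E (p ⊗ zP) ≋ ap F (p ⊗ zP)) →
    (∀ p s → ap E p ≋ ap F p → ap E (p ⊗ zδ s) ≋ ap F (p ⊗ zδ s)) →
    ∀ p → ap E p ≋ ap F p
  generator-induction E F base step-z step-δ = op-ext E F λ w →
    ≡.subst (λ w → ap E (word w) ≋ ap F (word w)) (LP.reverse-involutive w) (go (reverse w))
    where
    differ : ∀ p a u v → a ≋ u ⊖ v → ap E (p ⊗ u) ≋ ap F (p ⊗ u) →
             ap E (p ⊗ v) ≋ ap F (p ⊗ v) → ap E (p ⊗ a) ≋ ap F (p ⊗ a)
    differ p a u v e f h =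
      ≋-trans (ap-cong E (⊗-congˡ p e)) (≋-trans (op-⊗-⊖ E p u v) (≋-trans (⊖-cong f h)
        (≋-sym (≋-trans (ap-cong F (⊗-congˡ p e)) (op-⊗-⊖ F p u v)))))

    step : ∀ p a → ap E p ≋ ap F p → ap E (p ⊗ word [ a ]) ≋ ap F (p ⊗ word [ a ])
    step p 𝕩 ih = ≡.subst (λ u → ap E (p ⊗ u) ≋ ap F (p ⊗ u)) zδ-one (step-δ p one ih)
    step p (𝕪 t) ih with one-view t
    ... | inj₁ refl = differ p _ zP (zδ one) yP-one (step-z p ih) (step-δ p one ih)
    ... | inj₂ t≢1  = differ p _ (zδ t) (zδ one) (yP-other t t≢1) (step-δ p t ih) (step-δ p one ih)

    go : ∀ rw → ap E (word (reverse rw)) ≋ ap F (word (reverse rw))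
    go []       = base
    go (a ∷ rw) rewrite LP.unfold-reverse a rw = step (word (reverse rw)) a (go rw)

  -- For the map of a forest f ≠ 𝕀 this is rule (IV) at u = z: every forest of positive degree kills
  -- z, so only the term f ⊗ 𝕀 survives.
  CommutesWithZ : Op {r} → Set
  CommutesWithZ E = ∀ p → ap E (p ⊗ zP) ≋ ap E p ⊗ zP

  commutes-∘ : ∀ E F → CommutesWithZ E → CommutesWithZ F → CommutesWithZ (E ∘ₒ F)
  commutes-∘ E F e f p = ≋-trans (ap-cong E (f p)) (e _)

  commutes-+ : ∀ E F → CommutesWithZ E → CommutesWithZ F → CommutesWithZ (E +ₒ F)
  commutes-+ E F e f p = ≋-trans (⊕-cong (e p) (f p)) (≋-sym (⊗-distribʳ-⊕ zP (ap E p) (ap F p)))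

  commutes-scale : ∀ c E → CommutesWithZ E → CommutesWithZ (scaleₒ c E)
  commutes-scale c E e p = ≋-trans (scale-cong c (e p)) (≋-sym (ap-scale (Rₒ zP) c (ap E p)))

  commutes-R : CommutesWithZ (Rₒ zP)
  commutes-R p = ≋-refl

  zʸ : Fin r → Poly r
  zʸ s = zP ⊖ zδ s

  increment : Op {r} → Fin r → Op {r}
  increment E s = Rₒ (zʸ s) ∘ₒ E ∘ₒ Rₒ (zδ s)

  -- x = z_1^δ, y_1 = z − z_1^δ and y_t = z_t^δ − z_1^δ, where z itself contributes nothing.
  letterIncrement : Op {r} → Letter r → Op {r}
  letterIncrement E 𝕩     = increment E one
  letterIncrement E (𝕪 t) = (if isOne t then 0ₒ else increment E t) -ₒ increment E one

  -- The elements z and z_s^δ form another basis of the span of the letters, so rules for them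
  -- amount to rules for the letters. The latter serve as the definition, because they give a
  -- structural recursion on the reversed word; `𝒴-z` and `𝒴-δ` recover the former.
  𝒴-word : Op {r} → List (Letter r) → Poly r
  𝒴-word E []       = []
  𝒴-word E (a ∷ rw) = 𝒴-word E rw ⊗ word [ a ] ⊕ ap (letterIncrement E a) (word (reverse rw))

  𝒴 : Op {r} → Op {r}
  𝒴 E = linₒ (𝒴-word E ∘ reverse)

  module _ (E : Op {r}) where

    𝒴-1 : ap (𝒴 E) (word []) ≋ []
    𝒴-1 = lin-word (𝒴-word E ∘ reverse) []

    𝒴-letter : ∀ p a → ap (𝒴 E) (p ⊗ word [ a ])
                       ≋ ap (𝒴 E) p ⊗ word [ a ] ⊕ ap (letterIncrement E a) p
    𝒴-letter p a = op-ext (𝒴 E ∘ₒ Rₒ (word [ a ])) (Rₒ (word [ a ]) ∘ₒ 𝒴 E +ₒ letterIncrement E a)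
      (λ w → begin
        ap (𝒴 E) (word (w ++ [ a ]))
          ≈⟨ lin-word (𝒴-word E ∘ reverse) (w ++ [ a ]) ⟩
        𝒴-word E (reverse (w ++ [ a ]))
          ≡⟨ cong (𝒴-word E) (LP.reverse-++ w [ a ]) ⟩
        𝒴-word E (reverse w) ⊗ word [ a ] ⊕ ap (letterIncrement E a) (word (reverse (reverse w)))
          ≡⟨ cong (λ v → 𝒴-word E (reverse w) ⊗ word [ a ] ⊕ ap (letterIncrement E a) (word v))
                  (LP.reverse-involutive w) ⟩
        𝒴-word E (reverse w) ⊗ word [ a ] ⊕ ap (letterIncrement E a) (word w)
          ≈⟨ ⊕-congʳ (ap (letterIncrement E a) (word w)) (⊗-congʳ (word [ a ]) (lin-word (𝒴-word E ∘ reverse) w)) ⟨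
        ap (𝒴 E) (word w) ⊗ word [ a ] ⊕ ap (letterIncrement E a) (word w) ∎)
      p
      where open ≋-Reasoning

    𝒴-x : ∀ p → ap (𝒴 E) (p ⊗ xP) ≋ ap (𝒴 E) p ⊗ xP ⊕ ap (increment E one) p
    𝒴-x p = 𝒴-letter p 𝕩

    𝒴-y-one : ∀ p → ap (𝒴 E) (p ⊗ yP one) ≋ ap (𝒴 E) p ⊗ yP one ⊖ ap (increment E one) p
    𝒴-y-one p =
      ≡.subst (λ b → ap (𝒴 E) (p ⊗ yP one) ≋ ap (𝒴 E) p ⊗ yP one
                 ⊕ ap ((if b then 0ₒ else increment E one) -ₒ increment E one) p)
              isOne-one (𝒴-letter p (𝕪 one))

    𝒴-y-other : ∀ p t → isOne t ≡ false →
      ap (𝒴 E) (p ⊗ yP t) ≋ ap (𝒴 E) p ⊗ yP t ⊕ (ap (increment E t) p ⊖ ap (increment E one) p)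
    𝒴-y-other p t t≢1 =
      ≡.subst (λ b → ap (𝒴 E) (p ⊗ yP t) ≋ ap (𝒴 E) p ⊗ yP t
                 ⊕ ap ((if b then 0ₒ else increment E t) -ₒ increment E one) p)
              t≢1 (𝒴-letter p (𝕪 t))

    𝒴-z : CommutesWithZ (𝒴 E)
    𝒴-z p = begin
      ap (𝒴 E) (p ⊗ (xP ⊕ yP one))
        ≈⟨ op-⊗-⊕ (𝒴 E) p xP (yP one) ⟩
      ap (𝒴 E) (p ⊗ xP) ⊕ ap (𝒴 E) (p ⊗ yP one)
        ≈⟨ ⊕-cong (𝒴-x p) (𝒴-y-one p) ⟩
      _ ≈⟨ solve (ap (𝒴 E) p ∷ xP ∷ yP one ∷ ap (increment E one) p ∷ [])
                 (x₀ :* x₁ :+ x₃ :+ (x₀ :* x₂ :- x₃)) (x₀ :* (x₁ :+ x₂)) refl ⟩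
      ap (𝒴 E) p ⊗ zP ∎
      where open ≋-Reasoning

    𝒴-δ : ∀ p s → ap (𝒴 E) (p ⊗ zδ s) ≋ ap (𝒴 E) p ⊗ zδ s ⊕ ap E (p ⊗ zδ s) ⊗ zʸ s
    𝒴-δ p s with one-view s
    ... | inj₁ refl =
      ≡.subst (λ u → ap (𝒴 E) (p ⊗ u) ≋ ap (𝒴 E) p ⊗ u ⊕ ap (increment E one) p)
              (≡.sym zδ-one) (𝒴-x p)
    ... | inj₂ s≢1 =
      ≡.subst (λ u → ap (𝒴 E) (p ⊗ u) ≋ ap (𝒴 E) p ⊗ u ⊕ ap (increment E s) p)
              (≡.sym (zδ-other s s≢1)) (begin
      ap (𝒴 E) (p ⊗ (xP ⊕ yP s))
        ≈⟨ op-⊗-⊕ (𝒴 E) p xP (yP s) ⟩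
      ap (𝒴 E) (p ⊗ xP) ⊕ ap (𝒴 E) (p ⊗ yP s)
        ≈⟨ ⊕-cong (𝒴-x p) (𝒴-y-other p s s≢1) ⟩
      _ ≈⟨ solve (ap (𝒴 E) p ∷ xP ∷ yP s ∷ ap (increment E one) p ∷ ap (increment E s) p ∷ [])
                 (x₀ :* x₁ :+ x₃ :+ (x₀ :* x₂ :+ (x₄ :- x₃))) (x₀ :* (x₁ :+ x₂) :+ x₄) refl ⟩
      ap (𝒴 E) p ⊗ (xP ⊕ yP s) ⊕ ap (increment E s) p ∎)
      where open ≋-Reasoning

  -- At p = 1 and for E (1) = 0, the field `step` exhibits H (u) as the quotient of E (u) by z - u.
  -- Using a relation, instead of fixing E to be 𝒴 H, also admits the identity, which does not kill
  -- 1.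
  record Companion (E H : Op {r}) : Set where
    field
      upper-z : CommutesWithZ E
      lower-z : CommutesWithZ H
      step    : ∀ p s → ap E (p ⊗ zδ s) ≋ ap E p ⊗ zδ s ⊕ ap H (p ⊗ zδ s) ⊗ zʸ s

  open Companion public

  companion-𝒴 : ∀ E → CommutesWithZ E → Companion (𝒴 E) E
  companion-𝒴 E e = record { upper-z = 𝒴-z E ; lower-z = e ; step = 𝒴-δ E }

  companion-id : Companion idₒ 0ₒ
  companion-id = record
    { upper-z = λ _ → ≋-refl ; lower-z = λ _ → ≋-refl
    ; step = λ p s → ≋-sym (⊕-identityʳ _) }

  -- When all four operators commute with R_z, this is the K with E E′ - R_z K = (E - R_z H) (E′ -
  -- R_z H′).
  companionProduct : (E H E′ H′ : Op {r}) → Op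
  companionProduct E H E′ H′ = E ∘ₒ H′ +ₒ H ∘ₒ E′ -ₒ Rₒ zP ∘ₒ H ∘ₒ H′

  companionProduct-z : ∀ E H E′ H′ → Companion E H → Companion E′ H′ →
                       CommutesWithZ (companionProduct E H E′ H′)
  companionProduct-z E H E′ H′ c c′ =
    commutes-+ (E ∘ₒ H′ +ₒ H ∘ₒ E′) (scaleₒ (Q.- 1ℚ) (Rₒ zP ∘ₒ H ∘ₒ H′))
      (commutes-+ (E ∘ₒ H′) (H ∘ₒ E′)
        (commutes-∘ E H′ (upper-z c) (lower-z c′)) (commutes-∘ H E′ (lower-z c) (upper-z c′)))
      (commutes-scale (Q.- 1ℚ) (Rₒ zP ∘ₒ H ∘ₒ H′)
        (commutes-∘ (Rₒ zP) (H ∘ₒ H′) commutes-R (commutes-∘ H H′ (lower-z c) (lower-z c′))))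

  -- With A = E′ (p) and B = H′ (p u), E is applied to A u + B z - B u. The terms E (A u) and E (B
  -- u) expand by the step of E, while z leaves E (B z); the factor in front of z - u becomes E (B)
  -- + H (A u) - H (B u). The last two terms equal H (E′ (p u)) - H (B) z, which is the source of
  -- the correction R_z H H′.
  companion-∘ : ∀ E H E′ H′ → Companion E H → Companion E′ H′ →
                Companion (E ∘ₒ E′) (companionProduct E H E′ H′)
  companion-∘ E H E′ H′ c c′ = record
    { upper-z = commutes-∘ E E′ (upper-z c) (upper-z c′)
    ; lower-z = companionProduct-z E H E′ H′ c c′
    ; step    = step∘ }
    where
    open ≋-Reasoning
    step∘ : ∀ p s → ap E (ap E′ (p ⊗ zδ s))
      ≋ ap E (ap E′ p) ⊗ zδ s ⊕ ap (companionProduct E H E′ H′) (p ⊗ zδ s) ⊗ zʸ s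
    step∘ p s = begin
      ap E (ap E′ (p ⊗ u))
        ≈⟨ spread E ⟩
      ap E (A ⊗ u) ⊕ (ap E (B ⊗ zP) ⊖ ap E (B ⊗ u))
        ≈⟨ ⊕-cong (step c A s) (⊖-cong (upper-z c B) (step c B s)) ⟩
      ap E A ⊗ u ⊕ ap H (A ⊗ u) ⊗ zʸ s ⊕ (ap E B ⊗ zP ⊖ (ap E B ⊗ u ⊕ ap H (B ⊗ u) ⊗ zʸ s))
        ≈⟨ solve (ap E A ∷ u ∷ ap H (A ⊗ u) ∷ zP ∷ ap E B ∷ ap H (B ⊗ u) ∷ ap H B ∷ [])
             (x₀ :* x₁ :+ x₂ :* (x₃ :- x₁) :+ (x₄ :* x₃ :- (x₄ :* x₁ :+ x₅ :* (x₃ :- x₁))))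
             (x₀ :* x₁ :+ (x₄ :+ (x₂ :+ (x₆ :* x₃ :- x₅)) :- x₆ :* x₃) :* (x₃ :- x₁)) refl ⟩
      ap E A ⊗ u ⊕ (ap E B ⊕ (ap H (A ⊗ u) ⊕ (ap H B ⊗ zP ⊖ ap H (B ⊗ u))) ⊖ ap H B ⊗ zP) ⊗ zʸ s
        ≈⟨ outer (⊕-congˡ (ap H (A ⊗ u)) (⊕-congʳ (neg (ap H (B ⊗ u))) (lower-z c B))) ⟨
      ap E A ⊗ u ⊕ (ap E B ⊕ (ap H (A ⊗ u) ⊕ (ap H (B ⊗ zP) ⊖ ap H (B ⊗ u))) ⊖ ap H B ⊗ zP) ⊗ zʸ s
        ≈⟨ outer (spread H) ⟨
      ap E A ⊗ u ⊕ (ap E B ⊕ ap H (ap E′ (p ⊗ u)) ⊖ ap H B ⊗ zP) ⊗ zʸ s ∎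
      where
      u = zδ s
      A = ap E′ p
      B = ap H′ (p ⊗ u)
      outer : ∀ {k l} → k ≋ l →
        ap E A ⊗ u ⊕ (ap E B ⊕ k ⊖ ap H B ⊗ zP) ⊗ zʸ s ≋ ap E A ⊗ u ⊕ (ap E B ⊕ l ⊖ ap H B ⊗ zP) ⊗ zʸ s
      outer e = ⊕-congˡ (ap E A ⊗ u)
        (⊗-congʳ (zʸ s) (⊕-congʳ (neg (ap H B ⊗ zP)) (⊕-congˡ (ap E B) e)))
      spread : ∀ K → ap K (ap E′ (p ⊗ u)) ≋ ap K (A ⊗ u) ⊕ (ap K (B ⊗ zP) ⊖ ap K (B ⊗ u))
      spread K = ≋-trans (ap-cong K (step c′ p s))
        (≋-trans (ap-⊕ K (A ⊗ u) (B ⊗ zʸ s)) (⊕-congˡ (ap K (A ⊗ u)) (op-⊗-⊖ K B zP u)))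

  -- For a given H the companion rules are a recursion for E along products of generators, so the
  -- value at 1 decides. This is the tool for recognising an operator as a 𝒴: linear combinations,
  -- composites, and U_f for f ≠ 𝕀.
  𝒴-unique : ∀ E H → Companion E H → ap E (word []) ≋ [] → ∀ p → ap E p ≋ ap (𝒴 H) p
  𝒴-unique E H c e = generator-induction E (𝒴 H) (≋-trans e (≋-sym (𝒴-1 H)))
    (λ p ih → ≋-trans (upper-z c p) (≋-trans (⊗-congʳ zP ih) (≋-sym (𝒴-z H p))))
    (λ p s ih → ≋-trans (step c p s) (≋-trans (⊕-congʳ (ap H (p ⊗ zδ s) ⊗ zʸ s) (⊗-congʳ (zδ s) ih)) (≋-sym (𝒴-δ H p s))))

-- Sums over lists of terms without coefficients

module _ {r : ℕ} {A : Set} where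

  sum-cong : ∀ (l : List A) {f g : A → Poly r} → (∀ x → f x ≋ g x) → concatMap f l ≋ concatMap g l
  sum-cong []      e = ≋-refl
  sum-cong (x ∷ l) e = ⊕-cong (e x) (sum-cong l e)

  sum-zero : ∀ (l : List A) {f : A → Poly r} → (∀ x → f x ≋ []) → concatMap f l ≋ []
  sum-zero []      e = ≋-refl
  sum-zero (x ∷ l) e = ⊕-cong (e x) (sum-zero l e)

  sum-⊕ : ∀ (l : List A) (f g : A → Poly r) →
          concatMap f l ⊕ concatMap g l ≋ concatMap (λ x → f x ⊕ g x) l
  sum-⊕ []      f g = ≋-refl
  sum-⊕ (x ∷ l) f g = ≋-trans
    (solve (f x ∷ concatMap f l ∷ g x ∷ concatMap g l ∷ [])
           (x₀ :+ x₁ :+ (x₂ :+ x₃)) (x₀ :+ x₂ :+ (x₁ :+ x₃)) refl)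
    (⊕-congˡ (f x ⊕ g x) (sum-⊕ l f g))

  ap-sum : ∀ (E : Op) (l : List A) (f : A → Poly r) →
           ap E (concatMap f l) ≋ concatMap (λ x → ap E (f x)) l
  ap-sum E []      f = ap-[] E
  ap-sum E (x ∷ l) f = ≋-trans (ap-⊕ E (f x) _) (⊕-congˡ (ap E (f x)) (ap-sum E l f))

  sumₒ : List A → (A → Op {r}) → Op
  sumₒ l F = record
    { ap     = λ p → concatMap (λ x → ap (F x) p) l
    ; linear = go l }
    where
    go : ∀ l p g → ⟨ concatMap (λ x → ap (F x) p) l , g ⟩
                   ≡ ⟨ p , (λ w → ⟨ concatMap (λ x → ap (F x) (word w)) l , g ⟩) ⟩
    go []      p g = ≡.sym (pairing-0 p)
    go (x ∷ l) p g =
      ≡.trans (pairing-++ (ap (F x) p) _ g)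
        (≡.trans (cong₂ Q._+_ (linear (F x) p g) (go l p g))
        (≡.trans (≡.sym (pairing-+ p _ _))
                 (pairing-cong p λ w → ≡.sym (pairing-++ (ap (F x) (word w)) _ g))))

module _ {r : ℕ} {A B : Set} where

  sum-swap : ∀ (l : List A) (k : List B) (f : A → B → Poly r) →
             concatMap (λ x → concatMap (f x) k) l ≋ concatMap (λ y → concatMap (λ x → f x y) l) k
  sum-swap []      k f = ≋-sym (sum-zero k λ _ → ≋-refl)
  sum-swap (x ∷ l) k f =
    ≋-trans (⊕-congˡ (concatMap (f x) k) (sum-swap l k f))
            (sum-⊕ k (f x) (λ y → concatMap (λ x → f x y) l))

  sum-product : ∀ {C : Set} (l : List A) (k : List B) (m : A → B → C) (h : C → Poly r) →
    concatMap h (concatMap (λ x → map (m x) k) l) ≡ concatMap (λ x → concatMap (λ y → h (m x y)) k) l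
  sum-product []      k m h = refl
  sum-product (x ∷ l) k m h =
    ≡.trans (LP.concatMap-++ h (map (m x) k) _)
            (cong₂ _++_ (LP.concatMap-map h (m x) k) (sum-product l k m h))

-- The operators of forests

module _ {r : ℕ} .{{_ : NonZero r}} where

  mutual
    lowerT : Tree → Op {r}
    lowerT (node g) = Rₒ zP ∘ₒ lowerF g +ₒ upperF g

    lowerF : Forest → Op {r}
    lowerF []      = 0ₒ
    lowerF (t ∷ g) = companionProduct (upperT t) (lowerT t) (upperF g) (lowerF g)

    upperT : Tree → Op {r}
    upperT t = 𝒴 (lowerT t)

    upperF : Forest → Op {r}
    upperF []      = idₒ
    upperF (t ∷ g) = upperT t ∘ₒ upperF g

  mutual
    companionT : ∀ t → Companion (upperT t) (lowerT t)
    companionT (node g) = companion-𝒴 (lowerT (node g))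
      (commutes-+ (Rₒ zP ∘ₒ lowerF g) (upperF g)
        (commutes-∘ (Rₒ zP) (lowerF g) commutes-R (lower-z (companionF g)))
        (upper-z (companionF g)))

    companionF : ∀ f → Companion (upperF f) (lowerF f)
    companionF []      = companion-id
    companionF (t ∷ g) =
      companion-∘ (upperT t) (lowerT t) (upperF g) (lowerF g) (companionT t) (companionF g)

  upperF-1 : ∀ t f → ap (upperF (t ∷ f)) (word []) ≋ []
  upperF-1 t []       = 𝒴-1 (lowerT t)
  upperF-1 t (t′ ∷ f) = ≋-trans (ap-cong (upperT t) (upperF-1 t′ f)) (ap-[] (upperT t))

  lowerF-[_] : ∀ t p → ap (lowerF [ t ]) p ≋ ap (lowerT t) p
  lowerF-[ t ] p = ≋-trans
    (⊖-cong (⊕-congʳ (ap (lowerT t) p) (ap-[] (upperT t))) (⊗-congʳ zP (ap-[] (lowerT t))))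
    (⊕-identityʳ _)

  upperF-++ : ∀ f g p → ap (upperF (f ++ g)) p ≋ ap (upperF f) (ap (upperF g) p)
  upperF-++ []      g p = ≋-refl
  upperF-++ (t ∷ f) g p = ap-cong (upperT t) (upperF-++ f g p)

  -- In substance the associativity of `companionProduct`, as expected from the multiplicativity of
  -- U_f - R_z L_f. Commutation with z is used to move the correction terms out of the operators of
  -- the head tree.
  lowerF-++ : ∀ f g p → ap (lowerF (f ++ g)) p
              ≋ ap (companionProduct (upperF f) (lowerF f) (upperF g) (lowerF g)) p
  lowerF-++ []      g p = solve (ap (lowerF g) p ∷ []) x₀ (x₀ :+ :0 :- :0) refl
  lowerF-++ (t ∷ f) g p = begin
    ap T (ap (lowerF (f ++ g)) p) ⊕ ap S (ap (upperF (f ++ g)) p) ⊖ ap S (ap (lowerF (f ++ g)) p) ⊗ zP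
      ≈⟨ ⊖-cong (⊕-cong (spread T (upper-z (companionT t))) (ap-cong S (upperF-++ f g p)))
                (⊗-congʳ zP (spread S (lower-z (companionT t)))) ⟩
    _ ≈⟨ solve (ap T a ∷ ap T b ∷ ap T c ∷ ap S a ∷ ap S b ∷ ap S c ∷ ap S d ∷ zP ∷ [])
           (x₀ :+ x₁ :- x₂ :* x₇ :+ x₆ :- (x₃ :+ x₄ :- x₅ :* x₇) :* x₇)
           (x₀ :+ (x₁ :+ x₆ :- x₄ :* x₇) :- (x₂ :+ x₃ :- x₅ :* x₇) :* x₇) refl ⟩
    ap T a ⊕ (ap T b ⊕ ap S d ⊖ ap S b ⊗ zP) ⊖ (ap T c ⊕ ap S a ⊖ ap S c ⊗ zP) ⊗ zP ∎
    where
    open ≋-Reasoning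
    T = upperT t
    S = lowerT t
    a = ap (upperF f) (ap (lowerF g) p)
    b = ap (lowerF f) (ap (upperF g) p)
    c = ap (lowerF f) (ap (lowerF g) p)
    d = ap (upperF f) (ap (upperF g) p)
    spread : ∀ K → CommutesWithZ K → ap K (ap (lowerF (f ++ g)) p) ≋ ap K a ⊕ ap K b ⊖ ap K c ⊗ zP
    spread K e = ≋-trans (ap-cong K (lowerF-++ f g p))
      (≋-trans (ap-⊖ K (a ⊕ b) (c ⊗ zP)) (⊖-cong (ap-⊕ K a b) (e c)))

  module _ (K : Forest → Op {r}) where
    term : Poly r → Poly r → Forest × Forest → Poly r
    term p q x = ap (upperF (proj₁ x)) p ⊗ ap (K (proj₂ x)) q

    -- Left factors act through U even when `K` is `lowerF`: L_f (p q) is the sum of the U_{f'} (p)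
    -- L_{f''} (q). The companion step at p (q u) asks for this mixed shape, since there L_{f''} (q
    -- u) stands next to U_{f'} (p).
    Leibniz : Op {r} → List (Forest × Forest) → Set
    Leibniz E l = ∀ p q → ap E (p ⊗ q) ≋ concatMap (term p q) l

  -- Appending a generator to q is governed by companion rules on both sides: by that of E on the
  -- left, and by that of each f'' on the right. The rule for H supplies exactly the increments, so
  -- only q = 1 has to be assumed.
  leibniz-lift : ∀ E H l → Companion E H → Leibniz lowerF H l →
    (∀ p → ap E (p ⊗ word []) ≋ concatMap (term upperF p (word [])) l) → Leibniz upperF E l
  leibniz-lift E H l c lower base p =
    generator-induction (E ∘ₒ Lₒ p)
      (sumₒ l λ x → Lₒ (ap (upperF (proj₁ x)) p) ∘ₒ upperF (proj₂ x)) (base p) step-z step-δ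
    where
    open ≋-Reasoning
    step-z : ∀ q → ap E (p ⊗ q) ≋ concatMap (term upperF p q) l →
             ap E (p ⊗ (q ⊗ zP)) ≋ concatMap (term upperF p (q ⊗ zP)) l
    step-z q ih = begin
      ap E (p ⊗ (q ⊗ zP))                          ≈⟨ ap-cong E (⊗-assoc p q zP) ⟨
      ap E (p ⊗ q ⊗ zP)                            ≈⟨ upper-z c (p ⊗ q) ⟩
      ap E (p ⊗ q) ⊗ zP                            ≈⟨ ⊗-congʳ zP ih ⟩
      concatMap (term upperF p q) l ⊗ zP           ≈⟨ ap-sum (Rₒ zP) l (term upperF p q) ⟩
      concatMap (λ x → term upperF p q x ⊗ zP) l   ≈⟨ sum-cong l (λ x →
        ≋-trans (⊗-assoc (ap (upperF (proj₁ x)) p) (ap (upperF (proj₂ x)) q) zP)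
                (⊗-congˡ (ap (upperF (proj₁ x)) p) (≋-sym (upper-z (companionF (proj₂ x)) q)))) ⟩
      concatMap (term upperF p (q ⊗ zP)) l         ∎
    step-δ : ∀ q s → ap E (p ⊗ q) ≋ concatMap (term upperF p q) l →
             ap E (p ⊗ (q ⊗ zδ s)) ≋ concatMap (term upperF p (q ⊗ zδ s)) l
    step-δ q s ih = begin
      ap E (p ⊗ (q ⊗ u))
        ≈⟨ ap-cong E (⊗-assoc p q u) ⟨
      ap E (p ⊗ q ⊗ u)
        ≈⟨ step c (p ⊗ q) s ⟩
      ap E (p ⊗ q) ⊗ u ⊕ ap H (p ⊗ q ⊗ u) ⊗ zʸ s
        ≈⟨ ⊕-cong (⊗-congʳ u ih)
                  (⊗-congʳ (zʸ s) (≋-trans (ap-cong H (⊗-assoc p q u)) (lower p (q ⊗ u)))) ⟩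
      concatMap (term upperF p q) l ⊗ u ⊕ concatMap (term lowerF p (q ⊗ u)) l ⊗ zʸ s
        ≈⟨ ⊕-cong (ap-sum (Rₒ u) l (term upperF p q)) (ap-sum (Rₒ (zʸ s)) l (term lowerF p (q ⊗ u))) ⟩
      concatMap (λ x → term upperF p q x ⊗ u) l ⊕ concatMap (λ x → term lowerF p (q ⊗ u) x ⊗ zʸ s) l
        ≈⟨ sum-⊕ l _ _ ⟩
      concatMap (λ x → term upperF p q x ⊗ u ⊕ term lowerF p (q ⊗ u) x ⊗ zʸ s) l
        ≈⟨ sum-cong l (λ x → ≋-trans
             (solve (ap (upperF (proj₁ x)) p ∷ ap (upperF (proj₂ x)) q ∷ u
                       ∷ ap (lowerF (proj₂ x)) (q ⊗ u) ∷ zʸ s ∷ [])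
                    (x₀ :* x₁ :* x₂ :+ x₀ :* x₃ :* x₄) (x₀ :* (x₁ :* x₂ :+ x₃ :* x₄)) refl)
             (⊗-congˡ (ap (upperF (proj₁ x)) p) (≋-sym (step (companionF (proj₂ x)) q s)))) ⟩
      concatMap (term upperF p (q ⊗ u)) l ∎
      where u = zδ s

  sum-combine : ∀ {A : Set} (l : List A) (f g h : A → Poly r) →
    concatMap f l ⊕ concatMap g l ⊖ concatMap h l ⊗ zP ≋ concatMap (λ x → f x ⊕ g x ⊖ h x ⊗ zP) l
  sum-combine l f g h = ≋-trans
    (⊕-cong (sum-⊕ l f g) (ap-sum (scaleₒ (Q.- 1ℚ) (Rₒ zP)) l h))
    (sum-⊕ l (λ x → f x ⊕ g x) (λ x → neg (h x ⊗ zP)))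

  leibniz-∘ : ∀ K K′ E E′ l l′ → Leibniz K E l → Leibniz K′ E′ l′ → ∀ p q →
    ap E (ap E′ (p ⊗ q)) ≋ concatMap (λ x → concatMap (λ y →
      ap (upperF (proj₁ x)) (ap (upperF (proj₁ y)) p)
        ⊗ ap (K (proj₂ x)) (ap (K′ (proj₂ y)) q)) l′) l
  leibniz-∘ K K′ E E′ l l′ e e′ p q = begin
    ap E (ap E′ (p ⊗ q))
      ≈⟨ ap-cong E (e′ p q) ⟩
    ap E (concatMap (term K′ p q) l′)
      ≈⟨ ap-sum E l′ (term K′ p q) ⟩
    concatMap (λ y → ap E (term K′ p q y)) l′
      ≈⟨ sum-cong l′ (λ y → e (ap (upperF (proj₁ y)) p) (ap (K′ (proj₂ y)) q)) ⟩
    concatMap (λ y → concatMap (term K (ap (upperF (proj₁ y)) p) (ap (K′ (proj₂ y)) q)) l) l′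
      ≈⟨ sum-swap l l′ _ ⟨
    concatMap (λ x → concatMap (λ y →
      term K (ap (upperF (proj₁ y)) p) (ap (K′ (proj₂ y)) q) x) l′) l ∎
    where open ≋-Reasoning

  mutual
    -- The formula L_{B₊ g} = R_z L_g + U_g acts on right factors only, so it turns each f'' in Δ g
    -- into B₊ f''. The extra term B₊ g ⊗ 𝕀 of the coproduct contributes nothing because L_𝕀 = 0.
    leibnizT-lower : ∀ t → Leibniz lowerF (lowerT t) (ΔT t)
    leibnizT-lower (node g) p q = begin
      ap (lowerF g) (p ⊗ q) ⊗ zP ⊕ ap (upperF g) (p ⊗ q)
        ≈⟨ ⊕-cong (⊗-congʳ zP (leibnizF-lower g p q)) (leibnizF-upper g p q) ⟩
      concatMap (term lowerF p q) (ΔF g) ⊗ zP ⊕ concatMap (term upperF p q) (ΔF g)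
        ≈⟨ ⊕-congʳ _ (ap-sum (Rₒ zP) (ΔF g) (term lowerF p q)) ⟩
      concatMap (λ x → term lowerF p q x ⊗ zP) (ΔF g) ⊕ concatMap (term upperF p q) (ΔF g)
        ≈⟨ sum-⊕ (ΔF g) _ _ ⟩
      concatMap (λ x → term lowerF p q x ⊗ zP ⊕ term upperF p q x) (ΔF g)
        ≈⟨ sum-cong (ΔF g) (λ x → ≋-trans
             (solve (ap (upperF (proj₁ x)) p ∷ ap (lowerF (proj₂ x)) q ∷ zP
                       ∷ ap (upperF (proj₂ x)) q ∷ [])
                    (x₀ :* x₁ :* x₂ :+ x₀ :* x₃) (x₀ :* (x₁ :* x₂ :+ x₃)) refl)
             (⊗-congˡ (ap (upperF (proj₁ x)) p) (≋-sym (lowerF-[ node (proj₂ x) ] q)))) ⟩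
      concatMap (λ x → term lowerF p q (proj₁ x , [ node (proj₂ x) ])) (ΔF g)
        ≡⟨ LP.concatMap-map (term lowerF p q) _ (ΔF g) ⟨
      concatMap (term lowerF p q) (map (λ x → (proj₁ x , [ node (proj₂ x) ])) (ΔF g))
        ≈⟨ ⊕-congʳ _ (⊗-zeroʳ (ap (upperF [ node g ]) p)) ⟨
      concatMap (term lowerF p q) (ΔT (node g)) ∎
      where open ≋-Reasoning

    leibnizT-upper : ∀ t → Leibniz upperF (upperT t) (ΔT t)
    leibnizT-upper (node g) =
      leibniz-lift (upperT (node g)) (lowerT (node g)) (ΔT (node g))
        (companionT (node g)) (leibnizT-lower (node g)) base
      where
      open ≋-Reasoning
      base : ∀ p → ap (upperT (node g)) (p ⊗ word []) ≋ concatMap (term upperF p (word [])) (ΔT (node g))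
      base p = begin
        ap (upperT (node g)) (p ⊗ word [])
          ≈⟨ ap-cong (upperT (node g)) (⊗-identityʳ p) ⟩
        ap (upperT (node g)) p
          ≈⟨ ⊗-identityʳ (ap (upperT (node g)) p) ⟨
        ap (upperT (node g)) p ⊗ word []
          ≈⟨ ⊕-identityʳ _ ⟨
        ap (upperT (node g)) p ⊗ word [] ⊕ []
          -- At q = 1 only B₊ g ⊗ 𝕀 survives: every other right factor is a tree, whose operator
          -- kills 1.
          ≈⟨ ⊕-congˡ (ap (upperT (node g)) p ⊗ word []) (sum-zero (ΔF g) (λ x →
               ≋-trans (⊗-congˡ (ap (upperF (proj₁ x)) p) (𝒴-1 (lowerT (node (proj₂ x)))))
                       (⊗-zeroʳ (ap (upperF (proj₁ x)) p)))) ⟨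
        ap (upperT (node g)) p ⊗ word []
          ⊕ concatMap (λ x → term upperF p (word []) (proj₁ x , [ node (proj₂ x) ])) (ΔF g)
          ≡⟨ cong (ap (upperT (node g)) p ⊗ word [] ⊕_)
               (LP.concatMap-map (term upperF p (word [])) _ (ΔF g)) ⟨
        concatMap (term upperF p (word [])) (ΔT (node g)) ∎

    -- The three composites in the product formula share the left factor U_{f'} U_{g'}, so their
    -- right factors assemble into the companion product of f'' and g'', which `lowerF-++`
    -- identifies.
    leibnizF-lower : ∀ f → Leibniz lowerF (lowerF f) (ΔF f)
    leibnizF-lower []      p q = ≋-sym (≋-trans (⊕-identityʳ (p ⊗ [])) (⊗-zeroʳ p))
    leibnizF-lower (t ∷ g) p q = begin
      ap (upperT t) (ap (lowerF g) (p ⊗ q)) ⊕ ap (lowerT t) (ap (upperF g) (p ⊗ q))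
        ⊖ ap (lowerT t) (ap (lowerF g) (p ⊗ q)) ⊗ zP
        ≈⟨ ⊖-cong (⊕-cong
             (leibniz-∘ upperF lowerF (upperT t) (lowerF g) (ΔT t) (ΔF g)
               (leibnizT-upper t) (leibnizF-lower g) p q)
             (leibniz-∘ lowerF upperF (lowerT t) (upperF g) (ΔT t) (ΔF g)
               (leibnizT-lower t) (leibnizF-upper g) p q))
             (⊗-congʳ zP (leibniz-∘ lowerF lowerF (lowerT t) (lowerF g) (ΔT t) (ΔF g)
               (leibnizT-lower t) (leibnizF-lower g) p q)) ⟩
      _ ≈⟨ sum-combine (ΔT t) _ _ _ ⟩
      _ ≈⟨ sum-cong (ΔT t) (λ x → ≋-trans (sum-combine (ΔF g) _ _ _)
             (sum-cong (ΔF g) (λ y → merge x y))) ⟩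
      concatMap (λ x → concatMap (λ y →
        term lowerF p q (proj₁ x ++ proj₁ y , proj₂ x ++ proj₂ y)) (ΔF g)) (ΔT t)
        ≡⟨ sum-product (ΔT t) (ΔF g) _ (term lowerF p q) ⟨
      concatMap (term lowerF p q) (ΔF (t ∷ g)) ∎
      where
      open ≋-Reasoning
      merge : ∀ x y →
        ap (upperF (proj₁ x)) (ap (upperF (proj₁ y)) p) ⊗ ap (upperF (proj₂ x)) (ap (lowerF (proj₂ y)) q)
        ⊕ ap (upperF (proj₁ x)) (ap (upperF (proj₁ y)) p) ⊗ ap (lowerF (proj₂ x)) (ap (upperF (proj₂ y)) q)
        ⊖ ap (upperF (proj₁ x)) (ap (upperF (proj₁ y)) p)
            ⊗ ap (lowerF (proj₂ x)) (ap (lowerF (proj₂ y)) q) ⊗ zP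
        ≋ term lowerF p q (proj₁ x ++ proj₁ y , proj₂ x ++ proj₂ y)
      merge (x , x′) (y , y′) = ≋-trans
        (solve (ap (upperF x) (ap (upperF y) p) ∷ ap (upperF x′) (ap (lowerF y′) q)
                 ∷ ap (lowerF x′) (ap (upperF y′) q) ∷ ap (lowerF x′) (ap (lowerF y′) q) ∷ zP ∷ [])
               (x₀ :* x₁ :+ x₀ :* x₂ :- x₀ :* x₃ :* x₄) (x₀ :* (x₁ :+ x₂ :- x₃ :* x₄)) refl)
        (⊗-cong (≋-sym (upperF-++ x y p)) (≋-sym (lowerF-++ x′ y′ q)))

    leibnizF-upper : ∀ f → Leibniz upperF (upperF f) (ΔF f)
    leibnizF-upper []      p q = ≋-sym (⊕-identityʳ (p ⊗ q))
    leibnizF-upper (t ∷ g) p q = begin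
      ap (upperT t) (ap (upperF g) (p ⊗ q))
        ≈⟨ leibniz-∘ upperF upperF (upperT t) (upperF g) (ΔT t) (ΔF g)
             (leibnizT-upper t) (leibnizF-upper g) p q ⟩
      _ ≈⟨ sum-cong (ΔT t) (λ x → sum-cong (ΔF g) (λ y →
             ⊗-cong (≋-sym (upperF-++ (proj₁ x) (proj₁ y) p))
                    (≋-sym (upperF-++ (proj₂ x) (proj₂ y) q)))) ⟩
      concatMap (λ x → concatMap (λ y →
        term upperF p q (proj₁ x ++ proj₁ y , proj₂ x ++ proj₂ y)) (ΔF g)) (ΔT t)
        ≡⟨ sum-product (ΔT t) (ΔF g) _ (term upperF p q) ⟨
      concatMap (term upperF p q) (ΔF (t ∷ g)) ∎
      where open ≋-Reasoning

-- Rooted tree maps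

sizeF-++ : ∀ f g → sizeF (f ++ g) ≡ sizeF f ℕ.+ sizeF g
sizeF-++ []      g = refl
sizeF-++ (t ∷ f) g =
  ≡.trans (cong (sizeT t ℕ.+_) (sizeF-++ f g)) (≡.sym (ℕP.+-assoc (sizeT t) (sizeF f) (sizeF g)))

SplitsSize : ℕ → Forest × Forest → Set
SplitsSize n x = sizeF (proj₁ x) ℕ.+ sizeF (proj₂ x) ≡ n

mutual
  -- The grading of Δ keeps both tensor factors within the level bound when `appW` recurses through
  -- the coproduct.
  ΔT-size : ∀ t → All (SplitsSize (sizeT t)) (ΔT t)
  ΔT-size (node g) =
    ≡.trans (ℕP.+-identityʳ _) (ℕP.+-identityʳ _)
    ∷ AllP.map⁺ (All.map (λ {x} e → grow x e) (ΔF-size g))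
    where
    grow : ∀ x → SplitsSize (sizeF g) x → sizeF (proj₁ x) ℕ.+ (suc (sizeF (proj₂ x)) ℕ.+ 0) ≡ suc (sizeF g)
    grow x e = ≡.trans (cong (sizeF (proj₁ x) ℕ.+_) (ℕP.+-identityʳ _))
                       (≡.trans (ℕP.+-suc _ _) (cong suc e))

  ΔF-size : ∀ f → All (SplitsSize (sizeF f)) (ΔF f)
  ΔF-size []      = refl ∷ []
  ΔF-size (t ∷ f) = AllP.concat⁺ (AllP.map⁺ (All.map (λ {x} e →
    AllP.map⁺ (All.map (λ {y} e′ → add x y e e′) (ΔF-size f))) (ΔT-size t)))
    where
    add : ∀ x y → SplitsSize (sizeT t) x → SplitsSize (sizeF f) y →
          sizeF (proj₁ x ++ proj₁ y) ℕ.+ sizeF (proj₂ x ++ proj₂ y) ≡ sizeT t ℕ.+ sizeF f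
    add (a , b) (c , d) e e′ = begin
      sizeF (a ++ c) ℕ.+ sizeF (b ++ d)
        ≡⟨ cong₂ ℕ._+_ (sizeF-++ a c) (sizeF-++ b d) ⟩
      (sizeF a ℕ.+ sizeF c) ℕ.+ (sizeF b ℕ.+ sizeF d)
        ≡⟨ interchange (sizeF a) (sizeF c) (sizeF b) (sizeF d) ⟩
      (sizeF a ℕ.+ sizeF b) ℕ.+ (sizeF c ℕ.+ sizeF d)
        ≡⟨ cong₂ ℕ._+_ e e′ ⟩
      sizeT t ℕ.+ sizeF f ∎
      where
      open ≡.≡-Reasoning
      open CommSemigroupProperties ℕP.+-commutativeSemigroup using (interchange)

sum-cong-All : ∀ {r} {A : Set} {P : A → Set} {l : List A} {f g : A → Poly r} → All P l →
               (∀ x → P x → f x ≋ g x) → concatMap f l ≋ concatMap g l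
sum-cong-All []       e = ≋-refl
sum-cong-All (a ∷ as) e = ⊕-cong (e _ a) (sum-cong-All as e)

lin-cong : ∀ {r} {B : Set} {f g : B → Poly r} → (∀ b → f b ≋ g b) → ∀ p → lin f p ≋ lin g p
lin-cong {f = f} {g} e p = sum-cong p (λ t → scale-cong (proj₁ t) (e (proj₂ t)))

module _ {r : ℕ} .{{_ : NonZero r}} where

  rdivₒ : Op {r}
  rdivₒ = record
    { ap     = rdiv
    ; linear = λ p g → ≡.trans (transpose p g) (pairing-cong p λ w → ≡.sym
        (≡.trans (transpose (word w) g) (pairing-word w (λ w → ⟨ rdivW {r} 1ℚ (reverse w) , g ⟩)))) }
    where
    rdivW-scale : ∀ c rw g → ⟨ rdivW c rw , g ⟩ ≡ c Q.* ⟨ rdivW {r} 1ℚ rw , g ⟩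
    rdivW-scale c []         g = ≡.sym (QP.*-zeroʳ c)
    rdivW-scale c (𝕩 ∷ rw)   g = ≡.sym (QP.*-zeroʳ c)
    rdivW-scale c (𝕪 t ∷ rw) g with isOne t
    ... | true  = ≡.trans (QP.+-identityʳ _)
                    (cong (c Q.*_) (≡.sym (pairing-word (reverse rw) g)))
    ... | false = ≡.sym (QP.*-zeroʳ c)
    transpose : ∀ p g → ⟨ rdiv p , g ⟩ ≡ ⟨ p , (λ w → ⟨ rdivW {r} 1ℚ (reverse w) , g ⟩) ⟩
    transpose []            g = refl
    transpose ((c , w) ∷ p) g =
      ≡.trans (pairing-++ (rdivW c (reverse w)) _ g)
              (cong₂ Q._+_ (rdivW-scale c (reverse w) g) (transpose p g))

  rdiv-y : ∀ w t → rdiv (word w ⊗ yP t) ≡ (if isOne t then word w else []) ++ []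
  rdiv-y w t = ≡.trans
    (cong (λ v → rdivW 1ℚ v ++ []) (LP.reverse-++ w [ 𝕪 t ]))
    (cong (λ v → (if isOne t then word v else []) ++ []) (LP.reverse-involutive w))

  rdiv-y-one : ∀ p → rdiv (p ⊗ yP one) ≋ p
  rdiv-y-one = op-ext (rdivₒ ∘ₒ Rₒ (yP one)) idₒ λ w → ≋-reflexive
    (≡.trans (rdiv-y w one) (cong (λ b → (if b then word w else []) ++ []) isOne-one))

  rdiv-y-other : ∀ t → isOne t ≡ false → ∀ p → rdiv (p ⊗ yP t) ≋ []
  rdiv-y-other t t≢1 = op-ext (rdivₒ ∘ₒ Rₒ (yP t)) 0ₒ λ w → ≋-reflexive
    (≡.trans (rdiv-y w t) (cong (λ b → (if b then word w else []) ++ []) t≢1))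

  zʸ-other : ∀ t → isOne t ≡ false → zʸ t ≋ yP one ⊖ yP t
  zʸ-other t t≢1 = ≡.subst (λ u → zP ⊖ u ≋ yP one ⊖ yP t) (≡.sym (zδ-other t t≢1))
    (solve (xP ∷ yP one ∷ yP t ∷ []) (x₀ :+ x₁ :- (x₀ :+ x₂)) (x₁ :- x₂) refl)

  -- For s ≠ 1 the factor is y₁ - y_s, and `rdiv` discards the words ending in y_s.
  rdiv-zʸ : ∀ p s → rdiv (p ⊗ zʸ s) ≋ p
  rdiv-zʸ p s with one-view s
  ... | inj₁ refl = ≋-trans (ap-cong rdivₒ (⊗-congˡ p (≋-sym yP-one))) (rdiv-y-one p)
  ... | inj₂ s≢1  = ≋-trans (ap-cong rdivₒ (⊗-congˡ p (zʸ-other s s≢1)))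
    (≋-trans (op-⊗-⊖ rdivₒ p (yP one) (yP s))
    (≋-trans (⊖-cong (rdiv-y-one p) (rdiv-y-other s s≢1 p)) (⊕-identityʳ p)))

  upperF-z : ∀ t f → ap (upperF (t ∷ f)) zP ≋ []
  upperF-z t f = ≋-trans (ap-cong (upperF (t ∷ f)) (≋-sym (⊗-identityˡ zP)))
    (≋-trans (upper-z (companionF (t ∷ f)) (word [])) (⊗-congʳ zP (upperF-1 t f)))

  -- The companion rule at p = 1. It provides the right divisibility by z - z_s^δ on which rule (II)
  -- relies, and names the quotient.
  vanishing-step : ∀ E H → Companion E H → ap E (word []) ≋ [] → ∀ s →
                   ap E (zδ s) ≋ ap H (zδ s) ⊗ zʸ s
  vanishing-step E H c e s = begin
    ap E (zδ s)
      ≈⟨ ap-cong E (⊗-identityˡ (zδ s)) ⟨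
    ap E (word [] ⊗ zδ s)
      ≈⟨ step c (word []) s ⟩
    ap E (word []) ⊗ zδ s ⊕ ap H (word [] ⊗ zδ s) ⊗ zʸ s
      ≈⟨ ⊕-cong (⊗-congʳ (zδ s) e) (⊗-congʳ (zʸ s) (ap-cong H (⊗-identityˡ (zδ s)))) ⟩
    ap H (zδ s) ⊗ zʸ s ∎
    where open ≋-Reasoning

  -- Earlier clauses of `gen` inspect the head tree, so the product clause reduces only after that
  -- tree has been split.
  gen-product : ∀ n t t′ f u → gen {r} (suc n) (t ∷ t′ ∷ f) u ≡ appP n [ t ] (gen n (t′ ∷ f) u)
  gen-product n (node [])      t′ f u = refl
  gen-product n (node (_ ∷ _)) t′ f u = refl

  mutual
    gen-correct : ∀ n f u → sizeF f ℕ.≤ n → gen n f u ≋ ap (upperF f) (genPoly u)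
    gen-correct n       []                     u      _ = ≋-refl
    gen-correct (suc n) (node [] ∷ [])         Zg     _ = ≋-sym (upperF-z (node []) [])
    -- L_• computes to the identity, as its summand R_z L_𝕀 is the empty list; hence the quotient in
    -- rule (I) is z_s^δ itself.
    gen-correct (suc n) (node [] ∷ [])         (Dg s) _ = ≋-sym
      (vanishing-step (upperT (node [])) (lowerT (node [])) (companionT (node [])) (upperF-1 (node []) []) s)
    gen-correct (suc n) (node (t ∷ g) ∷ [])    Zg     _ = ≋-sym (upperF-z (node (t ∷ g)) [])
    gen-correct (suc n) (node (t ∷ g) ∷ [])    (Dg s) (ℕ.s≤s le) = begin
      rdiv (gen n (t ∷ g) (Dg s)) ⊗ (zP ⊕ zP ⊖ zδ s) ⊗ zʸ s
        ≈⟨ ⊗-congʳ (zʸ s) (⊗-congʳ (zP ⊕ zP ⊖ zδ s) (≋-trans (ap-cong rdivₒ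
             (≋-trans (gen-correct n (t ∷ g) (Dg s) (ℕP.≤-trans (ℕP.m≤m+n _ 0) le)) previous))
             (rdiv-zʸ l s))) ⟩
      l ⊗ (zP ⊕ zP ⊖ zδ s) ⊗ zʸ s
        -- Splitting 2z - z_s^δ as z + (z - z_s^δ) turns rule (II) into the recursion for `lowerT`.
        ≈⟨ solve (l ∷ zP ∷ zδ s ∷ []) (x₀ :* (x₁ :+ x₁ :- x₂) :* (x₁ :- x₂))
             ((x₀ :* x₁ :+ x₀ :* (x₁ :- x₂)) :* (x₁ :- x₂)) refl ⟩
      (l ⊗ zP ⊕ l ⊗ zʸ s) ⊗ zʸ s
        ≈⟨ ⊗-congʳ (zʸ s) (⊕-congˡ (l ⊗ zP) previous) ⟨
      ap (lowerT (node (t ∷ g))) (zδ s) ⊗ zʸ s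
        ≈⟨ vanishing-step (upperT (node (t ∷ g))) (lowerT (node (t ∷ g)))
             (companionT (node (t ∷ g))) (upperF-1 (node (t ∷ g)) []) s ⟨
      ap (upperT (node (t ∷ g))) (zδ s) ∎
      where
      open ≋-Reasoning
      l = ap (lowerF (t ∷ g)) (zδ s)
      previous : ap (upperF (t ∷ g)) (zδ s) ≋ l ⊗ zʸ s
      previous = vanishing-step (upperF (t ∷ g)) (lowerF (t ∷ g)) (companionF (t ∷ g)) (upperF-1 t g) s
    -- Exposing both roots shows that each of `[ node g ]` and `node h ∷ ts` misses at least one
    -- vertex, so both fit one level lower.
    gen-correct (suc n) (node g ∷ node h ∷ ts) u (ℕ.s≤s le) = ≋-trans
      (≋-reflexive (gen-product n (node g) (node h) ts u)) (≋-trans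
      (appP-correct n [ node g ] (gen n (node h ∷ ts) u) (ℕP.≤-trans size-head le))
      (ap-cong (upperT (node g)) (gen-correct n (node h ∷ ts) u (ℕP.≤-trans (ℕP.m≤n+m _ (sizeF g)) le))))
      where
      size-head : sizeF [ node g ] ℕ.≤ sizeF g ℕ.+ sizeF (node h ∷ ts)
      size-head = ℕP.≤-trans (ℕP.≤-reflexive (≡.trans (ℕP.+-identityʳ _) (ℕP.+-comm 1 (sizeF g))))
                             (ℕP.+-monoʳ-≤ (sizeF g) (ℕ.s≤s ℕ.z≤n))

    genL-correct : ∀ n f a → sizeF f ℕ.≤ n → genL n f a ≋ ap (upperF f) (word [ a ])
    genL-correct n f 𝕩 le =
      ≋-trans (gen-correct n f (Dg one) le) (≋-reflexive (cong (ap (upperF f)) zδ-one))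
    genL-correct n f (𝕪 t) le with one-view t
    ... | inj₁ refl = ≋-trans
      (≋-reflexive (cong (λ b → if b then gen n f Zg ⊖ gen n f (Dg one)
                                     else gen n f (Dg one) ⊖ gen n f (Dg one)) isOne-one))
      (≋-trans (⊖-cong (gen-correct n f Zg le) (gen-correct n f (Dg one) le))
      (≋-trans (≋-sym (ap-⊖ (upperF f) zP (zδ one))) (ap-cong (upperF f) (≋-sym yP-one))))
    ... | inj₂ t≢1 = ≋-trans
      (≋-reflexive (cong (λ b → if b then gen n f Zg ⊖ gen n f (Dg one)
                                     else gen n f (Dg t) ⊖ gen n f (Dg one)) t≢1))
      (≋-trans (⊖-cong (gen-correct n f (Dg t) le) (gen-correct n f (Dg one) le))
      (≋-trans (≋-sym (ap-⊖ (upperF f) (zδ t) (zδ one))) (ap-cong (upperF f) (≋-sym (yP-other t t≢1)))))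

    -- Rule (IV) is the Leibniz rule for U whose right factor is a single letter, so the two
    -- recursions agree term by term.
    appW-correct : ∀ n f rw → sizeF f ℕ.≤ n → appW n f rw ≋ ap (upperF f) (word (reverse rw))
    appW-correct n []      rw       le = ≋-refl
    appW-correct n (t ∷ f) []       le = ≋-sym (upperF-1 t f)
    appW-correct n (t ∷ f) (a ∷ rw) le = ≋-trans
      (sum-cong-All (ΔF-size (t ∷ f)) (λ x e → ⊗-cong
        (appW-correct n (proj₁ x) rw (ℕP.≤-trans (ℕP.m≤m+n _ _) (ℕP.≤-trans (ℕP.≤-reflexive e) le)))
        (genL-correct n (proj₂ x) a
          (ℕP.≤-trans (ℕP.m≤n+m _ (sizeF (proj₁ x))) (ℕP.≤-trans (ℕP.≤-reflexive e) le)))))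
      (≋-trans (≋-sym (leibnizF-upper (t ∷ f) (word (reverse rw)) (word [ a ])))
               (≋-reflexive (cong (λ w → ap (upperF (t ∷ f)) (word w))
                                  (≡.sym (LP.unfold-reverse a rw)))))

    appP-correct : ∀ n f p → sizeF f ℕ.≤ n → appP n f p ≋ ap (upperF f) p
    appP-correct n f p le = ≋-trans
      (lin-cong (λ w → ≋-trans (appW-correct n f (reverse w) le)
        (≋-reflexive (cong (λ w → ap (upperF f) (word w)) (LP.reverse-involutive w)))) p)
      (mk λ g → ≡.trans (pairing-lin _ p g) (≡.sym (linear (upperF f) p g)))

  treeMap-correct : ∀ h p → treeMap h p ≋ lin (λ f → ap (upperF f) p) h
  treeMap-correct h p = lin-cong (λ f → appP-correct (sizeF f) f p ℕP.≤-refl) h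

-- Diamond products as operators

if-true : ∀ {A : Set} {b} {p q : A} → b ≡ true → (if b then p else q) ≡ p
if-true refl = refl

if-false : ∀ {A : Set} {b} {p q : A} → b ≡ false → (if b then p else q) ≡ q
if-false refl = refl

module _ {r : ℕ} where

  lin-⊕ : ∀ {B : Set} (f g : B → Poly r) K → lin (λ b → f b ⊕ g b) K ≋ lin f K ⊕ lin g K
  lin-⊕ f g K = mk λ h → begin
    ⟨ lin (λ b → f b ⊕ g b) K , h ⟩
      ≡⟨ pairing-lin (λ b → f b ⊕ g b) K h ⟩
    ⟨ K , (λ b → ⟨ f b ⊕ g b , h ⟩) ⟩
      ≡⟨ pairing-cong K (λ b → pairing-++ (f b) (g b) h) ⟩
    ⟨ K , (λ b → ⟨ f b , h ⟩ Q.+ ⟨ g b , h ⟩) ⟩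
      ≡⟨ pairing-+ K (λ b → ⟨ f b , h ⟩) (λ b → ⟨ g b , h ⟩) ⟩
    ⟨ K , (λ b → ⟨ f b , h ⟩) ⟩ Q.+ ⟨ K , (λ b → ⟨ g b , h ⟩) ⟩
      ≡⟨ cong₂ Q._+_ (pairing-lin f K h) (pairing-lin g K h) ⟨
    ⟨ lin f K , h ⟩ Q.+ ⟨ lin g K , h ⟩
      ≡⟨ pairing-++ (lin f K) (lin g K) h ⟨
    ⟨ lin f K ⊕ lin g K , h ⟩ ∎
    where open ≡.≡-Reasoning

  ap-lin : ∀ {B : Set} (E : Op {r}) (f : B → Poly r) K → ap E (lin f K) ≋ lin (λ b → ap E (f b)) K
  ap-lin E f K = ≋-trans (ap-sum E K (λ t → scale (proj₁ t) (f (proj₂ t))))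
    (sum-cong K (λ t → ap-scale E (proj₁ t) (f (proj₂ t))))

  lin-linear : ∀ (E : Op {r}) p → lin (λ w → ap E (word w)) p ≋ ap E p
  lin-linear E p = mk λ g → ≡.trans (pairing-lin _ p g) (≡.sym (linear E p g))

  lin-scale : ∀ {B : Set} (f : B → Poly r) c K →
              lin f (map (λ t → c Q.* proj₁ t , proj₂ t) K) ≋ scale c (lin f K)
  lin-scale f c K = mk λ g → begin
    ⟨ lin f (map (λ t → c Q.* proj₁ t , proj₂ t) K) , g ⟩
      ≡⟨ pairing-lin f (map (λ t → c Q.* proj₁ t , proj₂ t) K) g ⟩
    ⟨ map (λ t → c Q.* proj₁ t , proj₂ t) K , (λ b → ⟨ f b , g ⟩) ⟩
      ≡⟨ pairing-scale c K (λ b → ⟨ f b , g ⟩) ⟩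
    c Q.* ⟨ K , (λ b → ⟨ f b , g ⟩) ⟩
      ≡⟨ cong (c Q.*_) (pairing-lin f K g) ⟨
    c Q.* ⟨ lin f K , g ⟩
      ≡⟨ pairing-scale c (lin f K) g ⟨
    ⟨ scale c (lin f K) , g ⟩ ∎
    where open ≡.≡-Reasoning

  combine : ∀ {B : Set} → (B → Op {r}) → List (ℚ × B) → Op {r}
  combine h K = sumₒ K λ t → scaleₒ (proj₁ t) (h (proj₂ t))

module _ {r : ℕ} .{{_ : NonZero r}} where

  𝒳 : Op {r} → Op {r}
  𝒳 E = Rₒ zP ∘ₒ E -ₒ 𝒴 E

  𝒳-z : ∀ E → CommutesWithZ E → CommutesWithZ (𝒳 E)
  𝒳-z E e = commutes-+ (Rₒ zP ∘ₒ E) (scaleₒ (Q.- 1ℚ) (𝒴 E))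
    (commutes-∘ (Rₒ zP) E commutes-R e) (commutes-scale (Q.- 1ℚ) (𝒴 E) (𝒴-z E))

  module _ (E : Op {r}) where
    open ≋-Reasoning

    increment-one : ∀ p → ap (increment E one) p ≋ ap E (p ⊗ xP) ⊗ yP one
    increment-one p = ⊗-cong (≋-reflexive (cong (λ u → ap E (p ⊗ u)) zδ-one)) (≋-sym yP-one)

    increment-other : ∀ p t → isOne t ≡ false →
      ap (increment E t) p ≋ (ap E (p ⊗ xP) ⊕ ap E (p ⊗ yP t)) ⊗ (yP one ⊖ yP t)
    increment-other p t t≢1 = ⊗-cong
      (≋-trans (≋-reflexive (cong (λ u → ap E (p ⊗ u)) (zδ-other t t≢1))) (op-⊗-⊕ E p xP (yP t)))
      (zʸ-other t t≢1)

    -- For E = D_v and p = z_s^δ w this is the rule for vy ⋄_s wx. The other five rules of the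
    -- diamond product follow in the same form.
    𝒴x : ∀ p → ap (𝒴 E) (p ⊗ xP) ≋ ap E (p ⊗ xP) ⊗ yP one ⊕ ap (𝒴 E) p ⊗ xP
    𝒴x p = begin
      ap (𝒴 E) (p ⊗ xP)
        ≈⟨ 𝒴-x E p ⟩
      ap (𝒴 E) p ⊗ xP ⊕ ap (increment E one) p
        ≈⟨ ⊕-congˡ (ap (𝒴 E) p ⊗ xP) (increment-one p) ⟩
      ap (𝒴 E) p ⊗ xP ⊕ ap E (p ⊗ xP) ⊗ yP one
        ≈⟨ solve (ap (𝒴 E) p ⊗ xP ∷ ap E (p ⊗ xP) ⊗ yP one ∷ []) (x₀ :+ x₁) (x₁ :+ x₀) refl ⟩
      ap E (p ⊗ xP) ⊗ yP one ⊕ ap (𝒴 E) p ⊗ xP ∎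

    -- The increment involves E (p x), whereas the rule for vy ⋄_s wy speaks of v ⋄_s wy and vx ⋄_s
    -- w. Commutation with z converts one into the other: E (p x) + E (p y₁) - 𝒴 E (p) = E (p) z - 𝒴
    -- E (p) = 𝒳 E (p).
    𝒴y-one : CommutesWithZ E → ∀ p →
      ap (𝒴 E) (p ⊗ yP one) ≋ ap E (p ⊗ yP one) ⊗ yP one ⊖ ap (𝒳 E) p ⊗ yP one
    𝒴y-one e p = begin
      ap (𝒴 E) (p ⊗ yP one)
        ≈⟨ 𝒴-y-one E p ⟩
      ap (𝒴 E) p ⊗ yP one ⊖ ap (increment E one) p
        ≈⟨ ⊖-cong (≋-refl {p = ap (𝒴 E) p ⊗ yP one}) (increment-one p) ⟩
      ap (𝒴 E) p ⊗ yP one ⊖ ap E (p ⊗ xP) ⊗ yP one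
        ≈⟨ solve (ap (𝒴 E) p ∷ yP one ∷ ap E (p ⊗ xP) ∷ ap E (p ⊗ yP one) ∷ [])
             (x₀ :* x₁ :- x₂ :* x₁) (x₃ :* x₁ :- (x₂ :+ x₃ :- x₀) :* x₁) refl ⟩
      ap E (p ⊗ yP one) ⊗ yP one
        ⊖ (ap E (p ⊗ xP) ⊕ ap E (p ⊗ yP one) ⊖ ap (𝒴 E) p) ⊗ yP one
        ≈⟨ ⊖-cong (≋-refl {p = ap E (p ⊗ yP one) ⊗ yP one}) (⊗-congʳ (yP one)
             (⊕-congʳ (neg (ap (𝒴 E) p)) (≋-trans (≋-sym (op-⊗-⊕ E p xP (yP one))) (e p)))) ⟩
      ap E (p ⊗ yP one) ⊗ yP one ⊖ ap (𝒳 E) p ⊗ yP one ∎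

    𝒴y-other : ∀ p t → isOne t ≡ false →
      ap (𝒴 E) (p ⊗ yP t) ≋ ap E (p ⊗ yP t) ⊗ yP one
        ⊖ (ap E (p ⊗ xP) ⊕ ap E (p ⊗ yP t)) ⊗ yP t ⊕ ap (𝒴 E) p ⊗ yP t
    𝒴y-other p t t≢1 = begin
      ap (𝒴 E) (p ⊗ yP t)
        ≈⟨ 𝒴-y-other E p t t≢1 ⟩
      ap (𝒴 E) p ⊗ yP t ⊕ (ap (increment E t) p ⊖ ap (increment E one) p)
        ≈⟨ ⊕-congˡ (ap (𝒴 E) p ⊗ yP t) (⊖-cong (increment-other p t t≢1) (increment-one p)) ⟩
      _ ≈⟨ solve (ap (𝒴 E) p ∷ yP t ∷ ap E (p ⊗ xP) ∷ ap E (p ⊗ yP t) ∷ yP one ∷ [])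
             (x₀ :* x₁ :+ ((x₂ :+ x₃) :* (x₄ :- x₁) :- x₂ :* x₄))
             (x₃ :* x₄ :- (x₂ :+ x₃) :* x₁ :+ x₀ :* x₁) refl ⟩
      ap E (p ⊗ yP t) ⊗ yP one ⊖ (ap E (p ⊗ xP) ⊕ ap E (p ⊗ yP t)) ⊗ yP t ⊕ ap (𝒴 E) p ⊗ yP t ∎

    -- Each 𝒳 rule is the matching 𝒴 rule subtracted from E (q) z, with z = x + y₁ expanded.
    𝒳x : ∀ p → ap (𝒳 E) (p ⊗ xP) ≋ ap E (p ⊗ xP) ⊗ xP ⊖ ap (𝒴 E) p ⊗ xP
    𝒳x p = ≋-trans (⊖-cong (≋-refl {p = ap E (p ⊗ xP) ⊗ zP}) (𝒴x p))
      (solve (ap E (p ⊗ xP) ∷ xP ∷ yP one ∷ ap (𝒴 E) p ∷ [])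
        (x₀ :* (x₁ :+ x₂) :- (x₀ :* x₂ :+ x₃ :* x₁)) (x₀ :* x₁ :- x₃ :* x₁) refl)

    𝒳y-one : CommutesWithZ E → ∀ p →
      ap (𝒳 E) (p ⊗ yP one) ≋ ap E (p ⊗ yP one) ⊗ xP ⊕ ap (𝒳 E) p ⊗ yP one
    𝒳y-one e p = ≋-trans (⊖-cong (≋-refl {p = ap E (p ⊗ yP one) ⊗ zP}) (𝒴y-one e p))
      (solve (ap E (p ⊗ yP one) ∷ xP ∷ yP one ∷ ap (𝒳 E) p ∷ [])
        (x₀ :* (x₁ :+ x₂) :- (x₀ :* x₂ :- x₃ :* x₂)) (x₀ :* x₁ :+ x₃ :* x₂) refl)

    𝒳y-other : ∀ p t → isOne t ≡ false →
      ap (𝒳 E) (p ⊗ yP t) ≋ ap E (p ⊗ yP t) ⊗ xP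
        ⊕ (ap E (p ⊗ xP) ⊕ ap E (p ⊗ yP t)) ⊗ yP t ⊖ ap (𝒴 E) p ⊗ yP t
    𝒳y-other p t t≢1 = ≋-trans (⊖-cong (≋-refl {p = ap E (p ⊗ yP t) ⊗ zP}) (𝒴y-other p t t≢1))
      (solve (ap E (p ⊗ yP t) ∷ xP ∷ yP one ∷ ap E (p ⊗ xP) ∷ yP t ∷ ap (𝒴 E) p ∷ [])
        (x₀ :* (x₁ :+ x₂) :- (x₀ :* x₂ :- (x₃ :+ x₀) :* x₄ :+ x₅ :* x₄))
        (x₀ :* x₁ :+ (x₃ :+ x₀) :* x₄ :- x₅ :* x₄) refl)

  -- As in the definition of ⋄, the words v are reversed.
  D : List L1 → Op {r}
  D []      = idₒ
  D (X ∷ v) = 𝒳 (D v)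
  D (Y ∷ v) = 𝒴 (D v)

  D-z : ∀ v → CommutesWithZ (D v)
  D-z []      _ = ≋-refl
  D-z (X ∷ v) = 𝒳-z (D v) (D-z v)
  D-z (Y ∷ v) = 𝒴-z (D v)

  -- The substitution ψ_s φ on 𝒜₁

  ·μ-identityʳ : ∀ (s : Fin r) → s ·μ one ≡ s
  ·μ-identityʳ s = FinP.toℕ-injective (≡.trans (FinP.toℕ-fromℕ< _)
    (≡.trans (cong (λ k → (toℕ s ℕ.+ k) % r) (FinP.toℕ-fromℕ< _))
    (≡.trans (cong (_% r) (ℕP.+-identityʳ _)) (m<n⇒m%n≡m (FinP.toℕ<n s)))))

  ·μ-identityˡ : ∀ (s : Fin r) → one ·μ s ≡ s
  ·μ-identityˡ s = FinP.toℕ-injective (≡.trans (FinP.toℕ-fromℕ< _)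
    (≡.trans (cong (λ k → (k ℕ.+ toℕ s) % r) (FinP.toℕ-fromℕ< _)) (m<n⇒m%n≡m (FinP.toℕ<n s))))

  φW-++ : ∀ v w → φW (v ++ w) ≋ φW {r} v ⊗ φW w
  φW-++ []      w = ≋-sym (⊗-identityˡ (φW w))
  φW-++ (a ∷ v) w = ≋-trans (⊗-congˡ (φL a) (φW-++ v w)) (≋-sym (⊗-assoc (φL a) (φW v) (φW w)))

  φL-y : ∀ s → φL (𝕪 s) ≋ zδ {r} s ⊖ zP
  φL-y s with one-view s
  ... | inj₁ refl = ≡.subst (λ b → (if b then neg (yP one) else yP one ⊖ yP one)
                                   ≋ (if b then xP else xP ⊕ yP one) ⊖ zP) (≡.sym isOne-one)
    (solve (xP ∷ yP one ∷ []) (:0 :- x₁) (x₀ :- (x₀ :+ x₁)) refl)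
  ... | inj₂ s≢1  = ≡.subst (λ b → (if b then neg (yP one) else yP s ⊖ yP one)
                                   ≋ (if b then xP else xP ⊕ yP s) ⊖ zP) (≡.sym s≢1)
    (solve (xP ∷ yP one ∷ yP s ∷ []) (x₂ :- x₁) (x₀ :+ x₂ :- (x₀ :+ x₁)) refl)

  module _ (s : Fin r) where
    open ≋-Reasoning

    rename : L1 → Letter r
    rename X = 𝕩
    rename Y = 𝕪 s

    𝓘W-emb : ∀ v → 𝓘W s (map emb v) ≡ map rename v
    𝓘W-emb []      = refl
    𝓘W-emb (X ∷ v) = cong (𝕩 ∷_) (𝓘W-emb v)
    𝓘W-emb (Y ∷ v) rewrite ·μ-identityʳ s = cong (𝕪 s ∷_) (𝓘W-emb v)

    -- M_s marks only the first y with s; the running product in 𝓘 then carries this s through all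
    -- later letters y₁.
    𝓘W-MW-emb : ∀ v → 𝓘W one (MW s (map emb v)) ≡ map rename v
    𝓘W-MW-emb []      = refl
    𝓘W-MW-emb (X ∷ v) = cong (𝕩 ∷_) (𝓘W-MW-emb v)
    𝓘W-MW-emb (Y ∷ v) rewrite ·μ-identityʳ s | ·μ-identityˡ s = cong (𝕪 s ∷_) (𝓘W-emb v)

    ψₒ : Op {r}
    ψₒ = linₒ φW ∘ₒ linₒ (λ w → word (𝓘W one w)) ∘ₒ linₒ (λ w → word (MW s w))

    ψ-emb : ∀ v → ap ψₒ (word (map emb v)) ≋ φW (map rename v)
    ψ-emb v = begin
      ap ψₒ (word (map emb v))
        ≈⟨ ap-cong (linₒ φW) (ap-cong (linₒ (λ w → word (𝓘W one w)))
             (lin-word (λ w → word (MW s w)) (map emb v))) ⟩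
      φ (𝓘 (word (MW s (map emb v))))
        ≈⟨ ap-cong (linₒ φW) (lin-word (λ w → word (𝓘W one w)) (MW s (map emb v))) ⟩
      φ (word (𝓘W one (MW s (map emb v))))
        ≈⟨ lin-word φW (𝓘W one (MW s (map emb v))) ⟩
      φW (𝓘W one (MW s (map emb v)))
        ≡⟨ cong φW (𝓘W-MW-emb v) ⟩
      φW (map rename v) ∎

    -- The values of ψ_s φ on the letters: x goes to x + y₁ under φ and then to z + (z_s^δ - z),
    -- while y goes to -y₁ and then to -(z_s^δ - z).
    θL : L1 → Poly r
    θL X = zδ s
    θL Y = zʸ s

    θ : Word₁ → Poly r
    θ []      = word []
    θ (a ∷ v) = θL a ⊗ θ v

    θ-snoc : ∀ v a → θ (v ++ [ a ]) ≋ θ v ⊗ θL a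
    θ-snoc []      a = ≋-trans (⊗-identityʳ (θL a)) (≋-sym (⊗-identityˡ (θL a)))
    θ-snoc (b ∷ v) a = ≋-trans (⊗-congˡ (θL b) (θ-snoc v a)) (≋-sym (⊗-assoc (θL b) (θ v) (θL a)))

    -- ψ_s is multiplicative on 𝒜₁ only, so a prefix u is carried along.
    ψ-φ-prefix : ∀ u v → ap ψₒ (word (map emb u) ⊗ φW (map emb v)) ≋ φW (map rename u) ⊗ θ v
    ψ-φ-prefix u [] = begin
      ap ψₒ (word (map emb u) ⊗ word [])  ≈⟨ ap-cong ψₒ (⊗-identityʳ (word (map emb u))) ⟩
      ap ψₒ (word (map emb u))            ≈⟨ ψ-emb u ⟩
      φW (map rename u)                   ≈⟨ ⊗-identityʳ (φW (map rename u)) ⟨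
      φW (map rename u) ⊗ word []         ∎
    ψ-φ-prefix u (a ∷ v) = cases a
      where
      c = φW (map rename u)
      w = word (map emb u)
      Φ = φW (map emb v)
      extend : ∀ b → ap ψₒ (w ⊗ word [ emb b ] ⊗ Φ) ≋ c ⊗ φL (rename b) ⊗ θ v
      extend b = begin
        ap ψₒ (w ⊗ word [ emb b ] ⊗ Φ)
          ≡⟨ cong (λ k → ap ψₒ (word k ⊗ Φ)) (LP.map-++ emb u [ b ]) ⟨
        ap ψₒ (word (map emb (u ++ [ b ])) ⊗ Φ)
          ≈⟨ ψ-φ-prefix (u ++ [ b ]) v ⟩
        φW (map rename (u ++ [ b ])) ⊗ θ v
          ≡⟨ cong (λ k → φW k ⊗ θ v) (LP.map-++ rename u [ b ]) ⟩
        φW (map rename u ++ [ rename b ]) ⊗ θ v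
          ≈⟨ ⊗-congʳ (θ v) (≋-trans (φW-++ (map rename u) [ rename b ])
               (⊗-congˡ c (⊗-identityʳ (φL (rename b))))) ⟩
        c ⊗ φL (rename b) ⊗ θ v ∎
      cases : ∀ a → ap ψₒ (w ⊗ (φL (emb a) ⊗ Φ)) ≋ c ⊗ (θL a ⊗ θ v)
      cases X = begin
        ap ψₒ (w ⊗ (zP ⊗ Φ))
          ≈⟨ ap-cong ψₒ (solve (w ∷ xP ∷ yP one ∷ Φ ∷ []) (x₀ :* ((x₁ :+ x₂) :* x₃))
               (x₀ :* x₁ :* x₃ :+ x₀ :* x₂ :* x₃) refl) ⟩
        ap ψₒ (w ⊗ xP ⊗ Φ ⊕ w ⊗ yP one ⊗ Φ)
          ≈⟨ ap-⊕ ψₒ (w ⊗ xP ⊗ Φ) (w ⊗ yP one ⊗ Φ) ⟩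
        ap ψₒ (w ⊗ xP ⊗ Φ) ⊕ ap ψₒ (w ⊗ yP one ⊗ Φ)
          ≈⟨ ⊕-cong (extend X) (≋-trans (extend Y) (⊗-congʳ (θ v) (⊗-congˡ c (φL-y s)))) ⟩
        c ⊗ zP ⊗ θ v ⊕ c ⊗ (zδ s ⊖ zP) ⊗ θ v
          ≈⟨ solve (c ∷ zP ∷ θ v ∷ zδ s ∷ []) (x₀ :* x₁ :* x₂ :+ x₀ :* (x₃ :- x₁) :* x₂)
               (x₀ :* (x₃ :* x₂)) refl ⟩
        c ⊗ (zδ s ⊗ θ v) ∎
      cases Y = begin
        ap ψₒ (w ⊗ (φL (𝕪 one) ⊗ Φ))
          ≈⟨ ap-cong ψₒ (⊗-congˡ w (⊗-congʳ Φ (≋-reflexive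
               (cong (λ b → if b then neg (yP one) else yP one ⊖ yP one) isOne-one)))) ⟩
        ap ψₒ (w ⊗ (neg (yP one) ⊗ Φ))
          ≈⟨ ap-cong ψₒ (solve (w ∷ yP one ∷ Φ ∷ []) (x₀ :* ((:0 :- x₁) :* x₂))
               (:0 :- x₀ :* x₁ :* x₂) refl) ⟩
        ap ψₒ (neg (w ⊗ yP one ⊗ Φ))
          ≈⟨ ap-scale ψₒ (Q.- 1ℚ) (w ⊗ yP one ⊗ Φ) ⟩
        neg (ap ψₒ (w ⊗ yP one ⊗ Φ))
          ≈⟨ neg-cong (≋-trans (extend Y) (⊗-congʳ (θ v) (⊗-congˡ c (φL-y s)))) ⟩
        neg (c ⊗ (zδ s ⊖ zP) ⊗ θ v)
          ≈⟨ solve (c ∷ zP ∷ θ v ∷ zδ s ∷ []) (:0 :- x₀ :* (x₃ :- x₁) :* x₂)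
               (x₀ :* ((x₁ :- x₃) :* x₂)) refl ⟩
        c ⊗ (zʸ s ⊗ θ v) ∎

    ψ-φ : ∀ v → ψ s (φ (word (map emb v))) ≋ θ v
    ψ-φ v = begin
      ap ψₒ (φ (word (map emb v)))       ≈⟨ ap-cong ψₒ (lin-word φW (map emb v)) ⟩
      ap ψₒ (φW (map emb v))             ≈⟨ ap-cong ψₒ (⊗-identityˡ (φW (map emb v))) ⟨
      ap ψₒ (word [] ⊗ φW (map emb v))   ≈⟨ ψ-φ-prefix [] v ⟩
      word [] ⊗ θ v                      ≈⟨ ⊗-identityˡ (θ v) ⟩
      θ v                                ∎

    dv-1 : ∀ v → dv s v [] ≋ θ (reverse v)
    dv-1 []      = ≋-refl
    dv-1 (b ∷ v) = ψ-φ (reverse (b ∷ v))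

    -- On z_s^δ, applying 𝒴 appends the factor z - z_s^δ, hence 𝒳 appends z - (z - z_s^δ) = z_s^δ.
    -- These are the letters of `θ`, which gives the base case w = 1 of the comparison with ⋄_s.
    D-δ : ∀ v → ap (D v) (zδ s) ≋ zδ s ⊗ θ (reverse v)
    D-δ []      = ≋-sym (⊗-identityʳ (zδ s))
    D-δ (b ∷ v) = ≋-trans (cases b) (⊗-congˡ (zδ s)
      (≋-trans (≋-sym (θ-snoc (reverse v) b)) (≋-reflexive (cong θ (≡.sym (LP.unfold-reverse b v))))))
      where
      vanish : ap (𝒴 (D v)) (zδ s) ≋ ap (D v) (zδ s) ⊗ zʸ s
      vanish = vanishing-step (𝒴 (D v)) (D v) (companion-𝒴 (D v) (D-z v)) (𝒴-1 (D v)) s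
      cases : ∀ b → ap (D (b ∷ v)) (zδ s) ≋ zδ s ⊗ (θ (reverse v) ⊗ θL b)
      cases Y = ≋-trans vanish (≋-trans (⊗-congʳ (zʸ s) (D-δ v)) (⊗-assoc (zδ s) (θ (reverse v)) (zʸ s)))
      cases X = begin
        ap (D v) (zδ s) ⊗ zP ⊖ ap (𝒴 (D v)) (zδ s)
          ≈⟨ ⊖-cong (≋-refl {p = ap (D v) (zδ s) ⊗ zP}) vanish ⟩
        ap (D v) (zδ s) ⊗ zP ⊖ ap (D v) (zδ s) ⊗ zʸ s
          ≈⟨ solve (ap (D v) (zδ s) ∷ zP ∷ zδ s ∷ []) (x₀ :* x₁ :- x₀ :* (x₁ :- x₂)) (x₀ :* x₂) refl ⟩
        ap (D v) (zδ s) ⊗ zδ s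
          ≈⟨ ⊗-congʳ (zδ s) (D-δ v) ⟩
        zδ s ⊗ θ (reverse v) ⊗ zδ s
          ≈⟨ ⊗-assoc (zδ s) (θ (reverse v)) (zδ s) ⟩
        zδ s ⊗ (θ (reverse v) ⊗ zδ s) ∎

    -- The outer induction shortens v and allows any w, as the rules for y_t with t ≠ 1 also call v
    -- ⋄_s wx. The inner one shortens w and treats both last letters of v at once, since the rule
    -- for vx may call vy and conversely.
    dv-correct : ∀ v rw → ap (D v) (zδ s ⊗ word (reverse rw)) ≋ zδ s ⊗ dv s v rw
    dv-correct []      rw = ≋-refl
    dv-correct (b ∷ v) rw = go b rw
      where
      u = zδ s
      E = D v
      snoc : ∀ a rw → u ⊗ word (reverse rw) ⊗ word [ a ] ≋ u ⊗ word (reverse (a ∷ rw))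
      snoc a rw = ≋-trans (⊗-assoc u (word (reverse rw)) (word [ a ]))
        (≋-reflexive (cong (λ w → u ⊗ word w) (≡.sym (LP.unfold-reverse a rw))))
      ih : ∀ a rw → ap E (u ⊗ word (reverse rw) ⊗ word [ a ]) ≋ u ⊗ dv s v (a ∷ rw)
      ih a rw = ≋-trans (ap-cong E (snoc a rw)) (dv-correct v (a ∷ rw))
      go : ∀ b rw → ap (D (b ∷ v)) (u ⊗ word (reverse rw)) ≋ u ⊗ d' s v b rw
      goX : ∀ a rw → ap (𝒳 E) (u ⊗ word (reverse rw) ⊗ word [ a ]) ≋ u ⊗ d' s v X (a ∷ rw)
      goY : ∀ a rw → ap (𝒴 E) (u ⊗ word (reverse rw) ⊗ word [ a ]) ≋ u ⊗ d' s v Y (a ∷ rw)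
      go b []       = ≋-trans (ap-cong (D (b ∷ v)) (⊗-identityʳ u))
        (≋-trans (D-δ (b ∷ v)) (⊗-congˡ u (≋-sym (dv-1 (b ∷ v)))))
      go X (a ∷ rw) = ≋-trans (ap-cong (𝒳 E) (≋-sym (snoc a rw))) (goX a rw)
      go Y (a ∷ rw) = ≋-trans (ap-cong (𝒴 E) (≋-sym (snoc a rw))) (goY a rw)
      goX 𝕩 rw = ≋-trans (𝒳x E (u ⊗ word (reverse rw)))
        (≋-trans (⊖-cong (⊗-congʳ xP (ih 𝕩 rw)) (⊗-congʳ xP (go Y rw)))
        (solve (u ∷ dv s v (𝕩 ∷ rw) ∷ xP ∷ d' s v Y rw ∷ [])
          (x₀ :* x₁ :* x₂ :- x₀ :* x₃ :* x₂) (x₀ :* (x₁ :* x₂ :- x₃ :* x₂)) refl))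
      goX (𝕪 t) rw with one-view t
      ... | inj₁ refl = ≋-trans (𝒳y-one E (D-z v) (u ⊗ word (reverse rw)))
        (≋-trans (⊕-cong (⊗-congʳ xP (ih (𝕪 one) rw)) (⊗-congʳ (yP one) (go X rw)))
        (≋-trans (solve (u ∷ dv s v (𝕪 one ∷ rw) ∷ xP ∷ d' s v X rw ∷ yP one ∷ [])
          (x₀ :* x₁ :* x₂ :+ x₀ :* x₃ :* x₄) (x₀ :* (x₁ :* x₂ :+ x₃ :* x₄)) refl)
        (⊗-congˡ u (≋-reflexive (≡.sym (if-true isOne-one))))))
      ... | inj₂ t≢1 = ≋-trans (𝒳y-other E (u ⊗ word (reverse rw)) t t≢1)
        (≋-trans (⊖-cong (⊕-cong (⊗-congʳ xP (ih (𝕪 t) rw))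
                                 (⊗-congʳ (yP t) (⊕-cong (ih 𝕩 rw) (ih (𝕪 t) rw))))
                         (⊗-congʳ (yP t) (go Y rw)))
        (≋-trans (solve (u ∷ dv s v (𝕪 t ∷ rw) ∷ xP ∷ dv s v (𝕩 ∷ rw) ∷ yP t ∷ d' s v Y rw ∷ [])
          (x₀ :* x₁ :* x₂ :+ (x₀ :* x₃ :+ x₀ :* x₁) :* x₄ :- x₀ :* x₅ :* x₄)
          (x₀ :* (x₁ :* x₂ :+ (x₃ :+ x₁) :* x₄ :- x₅ :* x₄)) refl)
        (⊗-congˡ u (≋-reflexive (≡.sym (if-false t≢1))))))
      goY 𝕩 rw = ≋-trans (𝒴x E (u ⊗ word (reverse rw)))
        (≋-trans (⊕-cong (⊗-congʳ (yP one) (ih 𝕩 rw)) (⊗-congʳ xP (go Y rw)))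
        (solve (u ∷ dv s v (𝕩 ∷ rw) ∷ xP ∷ d' s v Y rw ∷ yP one ∷ [])
          (x₀ :* x₁ :* x₄ :+ x₀ :* x₃ :* x₂) (x₀ :* (x₁ :* x₄ :+ x₃ :* x₂)) refl))
      goY (𝕪 t) rw with one-view t
      ... | inj₁ refl = ≋-trans (𝒴y-one E (D-z v) (u ⊗ word (reverse rw)))
        (≋-trans (⊖-cong (⊗-congʳ (yP one) (ih (𝕪 one) rw)) (⊗-congʳ (yP one) (go X rw)))
        (≋-trans (solve (u ∷ dv s v (𝕪 one ∷ rw) ∷ d' s v X rw ∷ yP one ∷ [])
          (x₀ :* x₁ :* x₃ :- x₀ :* x₂ :* x₃) (x₀ :* (x₁ :* x₃ :- x₂ :* x₃)) refl)
        (⊗-congˡ u (≋-reflexive (≡.sym (if-true isOne-one))))))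
      ... | inj₂ t≢1 = ≋-trans (𝒴y-other E (u ⊗ word (reverse rw)) t t≢1)
        (≋-trans (⊕-cong (⊖-cong (⊗-congʳ (yP one) (ih (𝕪 t) rw))
                                 (⊗-congʳ (yP t) (⊕-cong (ih 𝕩 rw) (ih (𝕪 t) rw))))
                         (⊗-congʳ (yP t) (go Y rw)))
        (≋-trans (solve (u ∷ dv s v (𝕪 t ∷ rw) ∷ yP one ∷ dv s v (𝕩 ∷ rw) ∷ yP t ∷ d' s v Y rw ∷ [])
          (x₀ :* x₁ :* x₂ :- (x₀ :* x₃ :+ x₀ :* x₁) :* x₄ :+ x₀ :* x₅ :* x₄)
          (x₀ :* (x₁ :* x₂ :- (x₃ :+ x₁) :* x₄ :+ x₅ :* x₄)) refl)
        (⊗-congˡ u (≋-reflexive (≡.sym (if-false t≢1))))))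

    diamond-lin : ∀ F w → F ⋄[ s ] w ≋ lin (λ v → lin (λ w → dv s (reverse v) (reverse w)) w) F
    diamond-lin F w = sum-cong F λ t → ≋-trans
      (sum-cong w λ u → mk λ g → ≡.trans
        (pairing-scale (proj₁ t Q.* proj₁ u) (dv s (reverse (proj₂ t)) (reverse (proj₂ u))) g)
        (≡.trans (QP.*-assoc (proj₁ t) (proj₁ u) _)
        (≡.sym (≡.trans
          (pairing-scale (proj₁ t) (scale (proj₁ u) (dv s (reverse (proj₂ t)) (reverse (proj₂ u)))) g)
          (cong (proj₁ t Q.*_)
            (pairing-scale (proj₁ u) (dv s (reverse (proj₂ t)) (reverse (proj₂ u))) g))))))
      (≋-sym (ap-sum (scaleₒ (proj₁ t) idₒ) w
        (λ u → scale (proj₁ u) (dv s (reverse (proj₂ t)) (reverse (proj₂ u))))))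

    diamond-correct : ∀ F w → zδ s ⊗ (F ⋄[ s ] w) ≋ ap (combine (λ v → D (reverse v)) F) (zδ s ⊗ w)
    diamond-correct F w = begin
      zδ s ⊗ (F ⋄[ s ] w)
        ≈⟨ ⊗-congˡ (zδ s) (diamond-lin F w) ⟩
      zδ s ⊗ lin (λ v → lin (λ w → dv s (reverse v) (reverse w)) w) F
        ≈⟨ ap-lin (Lₒ (zδ s)) (λ v → lin (λ w → dv s (reverse v) (reverse w)) w) F ⟩
      lin (λ v → zδ s ⊗ lin (λ w → dv s (reverse v) (reverse w)) w) F
        ≈⟨ lin-cong (λ v → begin
             zδ s ⊗ lin (λ w → dv s (reverse v) (reverse w)) w
               ≈⟨ ap-lin (Lₒ (zδ s)) (λ w → dv s (reverse v) (reverse w)) w ⟩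
             lin (λ w → zδ s ⊗ dv s (reverse v) (reverse w)) w
               ≈⟨ lin-cong (λ w → ≋-trans (≋-sym (dv-correct (reverse v) (reverse w)))
                    (≋-reflexive (cong (λ w → ap (D (reverse v)) (zδ s ⊗ word w))
                                       (LP.reverse-involutive w)))) w ⟩
             lin (λ w → ap (D (reverse v)) (zδ s ⊗ word w)) w
               ≈⟨ lin-linear (D (reverse v) ∘ₒ Lₒ (zδ s)) w ⟩
             ap (D (reverse v)) (zδ s ⊗ w) ∎) F ⟩
      lin (λ v → ap (D (reverse v)) (zδ s ⊗ w)) F ∎

-- Linear combinations of the operators D v

module _ {r : ℕ} .{{_ : NonZero r}} where

  infix 4 _≋ₒ_

  _≋ₒ_ : Op {r} → Op {r} → Set
  E ≋ₒ F = ∀ p → ap E p ≋ ap F p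

  -- The representative is kept as data because F_f is read off from it.
  record Representable (E : Op {r}) : Set where
    constructor _represents_
    field
      representative : Poly₁
      represented    : E ≋ₒ combine D representative

  open Representable public

  rep-cong : ∀ {E F} → E ≋ₒ F → Representable F → Representable E
  rep-cong e (K represents k) = K represents λ p → ≋-trans (e p) (k p)

  rep-D : ∀ v → Representable (D v)
  rep-D v = [ 1ℚ , v ] represents λ p → ≋-sym (lin-word (λ v → ap (D v) p) v)

  rep-0 : Representable 0ₒ
  rep-0 = [] represents λ _ → ≋-refl

  rep-+ : ∀ {E F} → Representable E → Representable F → Representable (E +ₒ F)
  rep-+ (K represents k) (L represents l) = (K ++ L) represents λ p →
    ≋-trans (⊕-cong (k p) (l p)) (≋-reflexive (≡.sym (LP.concatMap-++ _ K L)))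

  rep-scale : ∀ c {E} → Representable E → Representable (scaleₒ c E)
  rep-scale c (K represents k) = map (λ t → c Q.* proj₁ t , proj₂ t) K represents λ p →
    ≋-trans (scale-cong c (k p)) (≋-sym (lin-scale (λ v → ap (D v) p) c K))

  rep-- : ∀ {E F} → Representable E → Representable F → Representable (E -ₒ F)
  rep-- e f = rep-+ e (rep-scale (Q.- 1ℚ) f)

  rep-combine : ∀ {B : Set} (h : B → Op) → (∀ b → Representable (h b)) →
                ∀ K → Representable (combine h K)
  rep-combine h e []            = rep-0
  rep-combine h e ((c , b) ∷ K) = rep-+ (rep-scale c (e b)) (rep-combine h e K)

  rep-post : ∀ F → (∀ v → Representable (F ∘ₒ D v)) → ∀ {E} → Representable E → Representable (F ∘ₒ E)
  rep-post F f (K represents k) = rep-cong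
    (λ p → ≋-trans (ap-cong F (k p)) (ap-lin F (λ v → ap (D v) p) K))
    (rep-combine (λ v → F ∘ₒ D v) f K)

  -- By the definition of 𝒳, R_z D_v = D_{vx} + D_{vy}.
  rep-R : ∀ {E} → Representable E → Representable (Rₒ zP ∘ₒ E)
  rep-R = rep-post (Rₒ zP) λ v → rep-cong
    (λ p → solve (ap (D v) p ⊗ zP ∷ ap (𝒴 (D v)) p ∷ []) x₀ (x₀ :- x₁ :+ x₁) refl)
    (rep-+ (rep-D (X ∷ v)) (rep-D (Y ∷ v)))

  combine-z : ∀ {B : Set} (h : B → Op) → (∀ b → CommutesWithZ (h b)) → ∀ K → CommutesWithZ (combine h K)
  combine-z h e K p = ≋-trans (lin-cong (λ b → e b p) K) (≋-sym (ap-lin (Rₒ zP) (λ b → ap (h b) p) K))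

  -- The representative of 𝒴 E is that of E multiplied by y on the right.
  𝒴-combine : ∀ {E} K → E ≋ₒ combine D K → 𝒴 E ≋ₒ combine (λ v → D (Y ∷ v)) K
  𝒴-combine {E} K k p = ≋-sym (𝒴-unique (combine (λ v → 𝒴 (D v)) K) E
    (record
      { upper-z = combine-z (λ v → 𝒴 (D v)) (λ v → 𝒴-z (D v)) K
      ; lower-z = λ q → ≋-trans (k (q ⊗ zP))
          (≋-trans (combine-z D D-z K q) (⊗-congʳ zP (≋-sym (k q))))
      ; step    = λ q s → begin
          lin (λ v → ap (𝒴 (D v)) (q ⊗ zδ s)) K
            ≈⟨ lin-cong (λ v → 𝒴-δ (D v) q s) K ⟩
          lin (λ v → ap (𝒴 (D v)) q ⊗ zδ s ⊕ ap (D v) (q ⊗ zδ s) ⊗ zʸ s) K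
            ≈⟨ lin-⊕ (λ v → ap (𝒴 (D v)) q ⊗ zδ s) (λ v → ap (D v) (q ⊗ zδ s) ⊗ zʸ s) K ⟩
          lin (λ v → ap (𝒴 (D v)) q ⊗ zδ s) K ⊕ lin (λ v → ap (D v) (q ⊗ zδ s) ⊗ zʸ s) K
            ≈⟨ ⊕-cong (ap-lin (Rₒ (zδ s)) (λ v → ap (𝒴 (D v)) q) K)
                      (ap-lin (Rₒ (zʸ s)) (λ v → ap (D v) (q ⊗ zδ s)) K) ⟨
          lin (λ v → ap (𝒴 (D v)) q) K ⊗ zδ s ⊕ lin (λ v → ap (D v) (q ⊗ zδ s)) K ⊗ zʸ s
            ≈⟨ ⊕-congˡ (lin (λ v → ap (𝒴 (D v)) q) K ⊗ zδ s) (⊗-congʳ (zʸ s) (k (q ⊗ zδ s))) ⟨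
          lin (λ v → ap (𝒴 (D v)) q) K ⊗ zδ s ⊕ ap E (q ⊗ zδ s) ⊗ zʸ s ∎ })
    (≋-trans (lin-cong (λ v → 𝒴-1 (D v)) K) (sum-zero K λ _ → ≋-refl)) p)
    where open ≋-Reasoning

  rep-𝒴 : ∀ {E} → Representable E → Representable (𝒴 E)
  rep-𝒴 (K represents k) = rep-cong (𝒴-combine K k) (rep-combine (λ v → D (Y ∷ v)) (λ v → rep-D (Y ∷ v)) K)

  -- The composite kills 1 and has the companion product as companion, so `𝒴-unique` applies. It is
  -- the recursion through which composites stay in the span of the D_v.
  𝒴-∘-𝒴 : ∀ v w → 𝒴 (D v) ∘ₒ 𝒴 (D w) ≋ₒ 𝒴 (companionProduct (𝒴 (D v)) (D v) (𝒴 (D w)) (D w))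
  𝒴-∘-𝒴 v w = 𝒴-unique _ _
    (companion-∘ (𝒴 (D v)) (D v) (𝒴 (D w)) (D w)
      (companion-𝒴 (D v) (D-z v)) (companion-𝒴 (D w) (D-z w)))
    (≋-trans (ap-cong (𝒴 (D v)) (𝒴-1 (D w))) (ap-[] (𝒴 (D v))))

  -- In 𝒴 D_v 𝒴 D_w = 𝒴 (𝒴 D_v D_w + D_v 𝒴 D_w - R_z D_v D_w) the first summand shortens w, and the
  -- other two compose with D_v, which is covered by `rec`. A last letter x of w reduces to this
  -- case through 𝒳 = R_z - 𝒴.
  rep-𝒴-∘ : ∀ v → (∀ w → Representable (D v ∘ₒ D w)) → ∀ w → Representable (𝒴 (D v) ∘ₒ D w)
  rep-𝒴-∘ v rec []      = rep-cong (λ _ → ≋-refl) (rep-D (Y ∷ v))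
  rep-𝒴-∘ v rec (b ∷ w) = cases b
    where
    yy : Representable (𝒴 (D v) ∘ₒ 𝒴 (D w))
    yy = rep-cong (𝒴-∘-𝒴 v w)
      (rep-𝒴 (rep-- (rep-+ (rep-𝒴-∘ v rec w) (rec (Y ∷ w))) (rep-R (rec w))))
    cases : ∀ b → Representable (𝒴 (D v) ∘ₒ D (b ∷ w))
    cases Y = yy
    cases X = rep-cong
      (λ p → ≋-trans (ap-⊖ (𝒴 (D v)) (ap (D w) p ⊗ zP) (ap (𝒴 (D w)) p))
        (⊕-congʳ (neg (ap (𝒴 (D v)) (ap (𝒴 (D w)) p))) (𝒴-z (D v) (ap (D w) p))))
      (rep-- (rep-R (rep-𝒴-∘ v rec w)) yy)

  rep-D-∘ : ∀ v w → Representable (D v ∘ₒ D w)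
  rep-D-∘ []      w = rep-cong (λ _ → ≋-refl) (rep-D w)
  rep-D-∘ (Y ∷ v) w = rep-𝒴-∘ v (rep-D-∘ v) w
  rep-D-∘ (X ∷ v) w = rep-cong (λ _ → ≋-refl)
    (rep-- (rep-R (rep-D-∘ v w)) (rep-𝒴-∘ v (rep-D-∘ v) w))

  rep-∘ : ∀ {E F} → Representable E → Representable F → Representable (E ∘ₒ F)
  rep-∘ {F = F} (K represents k) f = rep-cong (λ p → k (ap F p))
    (rep-combine (λ v → D v ∘ₒ F) (λ v → rep-post (D v) (rep-D-∘ v) f) K)

  mutual
    rep-lowerT : ∀ t → Representable (lowerT t)
    rep-lowerT (node g) = rep-+ (rep-R (rep-lowerF g)) (rep-upperF g)

    rep-lowerF : ∀ f → Representable (lowerF f)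
    rep-lowerF []      = rep-0
    rep-lowerF (t ∷ g) =
      rep-- (rep-+ (rep-∘ (rep-𝒴 (rep-lowerT t)) (rep-lowerF g)) (rep-∘ (rep-lowerT t) (rep-upperF g)))
            (rep-R (rep-∘ (rep-lowerT t) (rep-lowerF g)))

    rep-upperF : ∀ f → Representable (upperF f)
    rep-upperF []      = rep-D []
    rep-upperF (t ∷ g) = rep-∘ (rep-𝒴 (rep-lowerT t)) (rep-upperF g)

-- The element F_f of 𝒜₁¹

EmptyOrEndsInY : ℚ × Word₁ → Set
EmptyOrEndsInY t = (proj₂ t ≡ []) ⊎ (∃ λ u → proj₂ t ≡ u ++ [ Y ])

inA11 : ∀ F → All EmptyOrEndsInY F → InA11 F
inA11 []            _        v c≢0 = ⊥-elim (c≢0 refl)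
inA11 ((c , w) ∷ F) (e ∷ es) v c≢0 with LP.≡-dec _≟1_ w v
... | yes refl = e
... | no  _    = inA11 F es v c≢0

module _ {r : ℕ} .{{_ : NonZero r}} where

  D′ : Word₁ → Op {r}
  D′ v = D (reverse v)

  -- Built from L_f by appending y, using U_f = 𝒴 L_f for f ≠ 𝕀; the representative from
  -- `rep-upperF` would give no control over last letters.
  forestElement : Forest → Poly₁
  forestElement []      = [ 1ℚ , [] ]
  forestElement (t ∷ g) = map (λ x → proj₁ x , reverse (Y ∷ proj₂ x)) (representative (rep-lowerF {r} (t ∷ g)))

  forestElement-correct : ∀ f p → ap (upperF f) p ≋ ap (combine D′ (forestElement f)) p
  forestElement-correct []      p = ≋-sym (lin-word (λ v → ap (D′ v) p) [])
  forestElement-correct (t ∷ g) p = begin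
    ap (upperF (t ∷ g)) p
      ≈⟨ 𝒴-unique (upperF (t ∷ g)) (lowerF (t ∷ g)) (companionF (t ∷ g)) (upperF-1 t g) p ⟩
    ap (𝒴 (lowerF (t ∷ g))) p
      ≈⟨ 𝒴-combine K (represented (rep-lowerF (t ∷ g))) p ⟩
    lin (λ v → ap (D (Y ∷ v)) p) K
      ≡⟨ LP.concatMap-cong (λ x → cong (λ v → scale (proj₁ x) (ap (D v) p))
           (≡.sym (LP.reverse-involutive (Y ∷ proj₂ x)))) K ⟩
    lin (λ v → ap (D′ (reverse (Y ∷ v))) p) K
      ≡⟨ LP.concatMap-map _ _ K ⟨
    lin (λ v → ap (D′ v) p) (forestElement (t ∷ g)) ∎
    where
    open ≋-Reasoning
    K = representative (rep-lowerF {r} (t ∷ g))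

  forestElement-A11 : ∀ f → All EmptyOrEndsInY (forestElement f)
  forestElement-A11 []      = inj₁ refl ∷ []
  forestElement-A11 (t ∷ g) = AllP.map⁺ (All.universal
    (λ x → inj₂ (reverse (proj₂ x) , LP.unfold-reverse Y (proj₂ x))) _)

  element : ℋ → Poly₁
  element = concatMap λ t → map (λ x → proj₁ t Q.* proj₁ x , proj₂ x) (forestElement (proj₂ t))

  element-A11 : ∀ h → All EmptyOrEndsInY (element h)
  element-A11 h = AllP.concat⁺ (AllP.map⁺ (All.universal
    (λ t → AllP.map⁺ (forestElement-A11 (proj₂ t))) h))

  element-correct : ∀ h p → treeMap h p ≋ ap (combine D′ (element h)) p
  element-correct h p = ≋-trans (treeMap-correct h p) (go h)
    where
    go : ∀ h → lin (λ f → ap (upperF f) p) h ≋ lin (λ v → ap (D′ v) p) (element h)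
    go []            = ≋-refl
    go ((c , f) ∷ h) = ≋-trans
      (⊕-cong (≋-trans (scale-cong c (forestElement-correct f p))
                       (≋-sym (lin-scale (λ v → ap (D′ v) p) c (forestElement f))))
              (go h))
      (≋-reflexive (≡.sym (LP.concatMap-++ _ (map (λ x → c Q.* proj₁ x , proj₂ x) (forestElement f)) _)))

-- Coefficients and uniqueness

indicator : Bool → ℚ
indicator b = if b then 1ℚ else 0ℚ

add-if : ∀ b c d → (if b then c Q.+ d else d) ≡ c Q.* indicator b Q.+ d
add-if true  c d = cong (Q._+ d) (≡.sym (QP.*-identityʳ c))
add-if false c d = ≡.sym (≡.trans (cong (Q._+ d) (QP.*-zeroʳ c)) (QP.+-identityˡ d))

coeff-pairing : ∀ {r} (p : Poly r) w → coeff p w ≡ ⟨ p , (λ v → indicator (does (LP.≡-dec _≟L_ v w))) ⟩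
coeff-pairing []            w = refl
coeff-pairing ((c , v) ∷ p) w = ≡.trans (add-if (does (LP.≡-dec _≟L_ v w)) c (coeff p w))
  (cong (c Q.* indicator (does (LP.≡-dec _≟L_ v w)) Q.+_) (coeff-pairing p w))

coeff₁-pairing : ∀ p w → coeff₁ p w ≡ ⟨ p , (λ v → indicator (does (LP.≡-dec _≟1_ v w))) ⟩
coeff₁-pairing []            w = refl
coeff₁-pairing ((c , v) ∷ p) w = ≡.trans (add-if (does (LP.≡-dec _≟1_ v w)) c (coeff₁ p w))
  (cong (c Q.* indicator (does (LP.≡-dec _≟1_ v w)) Q.+_) (coeff₁-pairing p w))

≋⇒≈ : ∀ {r} {p q : Poly r} → p ≋ q → p ≈ q
≋⇒≈ {p = p} {q} e w =
  ≡.trans (coeff-pairing p w) (≡.trans (pair e _) (≡.sym (coeff-pairing q w)))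

module _ {r : ℕ} .{{_ : NonZero r}} where

  emb-injective : ∀ {a b} → emb {r} a ≡ emb b → a ≡ b
  emb-injective {X} {X} e = refl
  emb-injective {Y} {Y} e = refl

  -- For s = 1 the substitution is the identity: z_1^δ = x and z - z_1^δ = y₁.
  θ-one : ∀ v → θ one v ≋ word {r} (map emb v)
  θ-one []      = ≋-refl
  θ-one (X ∷ v) = ⊗-cong (≋-reflexive zδ-one) (θ-one v)
  θ-one (Y ∷ v) = ⊗-cong (≋-sym yP-one) (θ-one v)

  -- v ⋄₁ 1 = v, which recovers every coefficient of G.
  coeff-diamond : ∀ G v → coeff (zδ {r} one ⊗ (G ⋄[ one ] word [])) (𝕩 ∷ map emb v) ≡ coeff₁ G v
  coeff-diamond G v = begin
    coeff (zδ one ⊗ (G ⋄[ one ] word [])) w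
      ≡⟨ ≋⇒≈ (≋-trans (⊗-cong (≋-reflexive zδ-one) (≋-trans (diamond-lin one G (word []))
           (lin-cong (λ u → ≋-trans (lin-word (λ w → dv one (reverse u) (reverse w)) [])
             (≋-trans (dv-1 one (reverse u))
             (≋-trans (≋-reflexive (cong (θ one) (LP.reverse-involutive u))) (θ-one u)))) G)))
         (ap-lin (Lₒ xP) (λ u → word (map emb u)) G)) w ⟩
    coeff (lin (λ u → word (𝕩 ∷ map emb u)) G) w
      ≡⟨ coeff-pairing (lin (λ u → word (𝕩 ∷ map emb u)) G) w ⟩
    ⟨ lin (λ u → word (𝕩 ∷ map emb u)) G , (λ u → indicator (does (LP.≡-dec _≟L_ u w))) ⟩
      ≡⟨ pairing-lin (λ u → word (𝕩 ∷ map emb u)) G _ ⟩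
    ⟨ G , (λ u → ⟨ word (𝕩 ∷ map emb u) , (λ u → indicator (does (LP.≡-dec _≟L_ u w))) ⟩) ⟩
      ≡⟨ pairing-cong G (λ u → ≡.trans
           (pairing-word (𝕩 ∷ map emb u) (λ u → indicator (does (LP.≡-dec _≟L_ u w))))
           (cong indicator (same u))) ⟩
    ⟨ G , (λ u → indicator (does (LP.≡-dec _≟1_ u v))) ⟩
      ≡⟨ coeff₁-pairing G v ⟨
    coeff₁ G v ∎
    where
    open ≡.≡-Reasoning
    w : Word r
    w = 𝕩 ∷ map emb v
    same : ∀ u → does (LP.≡-dec _≟L_ (𝕩 ∷ map emb u) w) ≡ does (LP.≡-dec _≟1_ u v)
    same u = does-⇔ (mk⇔ (λ e → LP.map-injective emb-injective (LP.∷-injectiveʳ e))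
                         (λ e → cong (λ u → 𝕩 ∷ map emb u) e))
      (LP.≡-dec _≟L_ (𝕩 ∷ map emb u) w) (LP.≡-dec _≟1_ u v)

theorem2p1 : (r : ℕ) .{{_ : NonZero r}} (f : ℋ) →
    Σ Poly₁ λ F →
    InA11 F
    × (∀ (s : Fin r) (w : Poly r) → treeMap f (zδ s ⊗ w) ≈ zδ s ⊗ (F ⋄[ s ] w))
    × (∀ (G : Poly₁) → InA11 G
    → (∀ (s : Fin r) (w : Poly r) → treeMap f (zδ s ⊗ w) ≈ zδ s ⊗ (G ⋄[ s ] w))
    → G ≈₁ F)
theorem2p1 r f = F , inA11 F (element-A11 {r} f) , holds , λ G _ G-holds v → begin
    coeff₁ G v                                                      ≡⟨ coeff-diamond {r} G v ⟨
    -- The two identities are compared at s = 1 and w = 1, where the coefficient of the word x v is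
    -- that of v in G or in F.
    coeff (zδ {r} one ⊗ (G ⋄[ one ] word [])) (𝕩 ∷ map emb v)       ≡⟨ G-holds one (word []) _ ⟨
    coeff (treeMap f (zδ {r} one ⊗ word [])) (𝕩 ∷ map emb v)        ≡⟨ holds one (word []) _ ⟩
    coeff (zδ {r} one ⊗ (F ⋄[ one ] word [])) (𝕩 ∷ map emb v)       ≡⟨ coeff-diamond {r} F v ⟩
    coeff₁ F v                                                      ∎
  where
  open ≡.≡-Reasoning
  F : Poly₁
  F = element {r} f
  holds : ∀ (s : Fin r) (w : Poly r) → treeMap f (zδ s ⊗ w) ≈ zδ s ⊗ (F ⋄[ s ] w)
  holds s w = ≋⇒≈ (≋-trans (element-correct f (zδ s ⊗ w)) (≋-sym (diamond-correct s F w)))
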